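{- For every total Boolean function $f$, $$\mathsf{CG}^{\mathrm{pub}}(f)\leq \mathsf{CG}^{\mathrm{priv}}(f)\leq O(\mathsf{CG}^{\mathrm{pub}}(f)^{3}),$$ where the constant hidden in $O(\cdot)$ is absolute (independent of $f$ and of the number of input bits).
   Context: Let $f:\{0,1\}^n\to\{0,1\}$, $[n]=\{1,\dots,n\}$. In the certificate game, one player receives $x\in f^{ -1}(0)$, the other $y\in f^{ -1}(1)$, and without communication they must output a common index $i$ with $x_i\ne y_i$. Private coins: $\mathsf{CG}^{\mathrm{priv}}(f)=\min_p\max_{x\in f^{ -1}(0),y\in f^{ -1}(1)}\Big(\sum_{i:x_i\neq y_i}p_{x,i}p_{y,i}\Big)^{ -1}$, where $p=\{p_{x,i}\}$ ranges over nonnegative families with $\sum_{i\in[n]}p_{x,i}=1$ for each input $x$. Public coins: a deterministic strategy is a pair $(A,B)$ with $A:f^{ -1}(0)\to[n]$, $B:f^{ -1}(1)\to[n]$; it is correct on $(x,y)$ if $A(x)=B(y)=i$ with $x_i\ne y_i$. Then $\mathsf{CG}^{\mathrm{pub}}(f)=\min_{p}\max_{x\in f^{ -1}(0),y\in f^{ -1}(1)}\Big(\sum_{(A,B)\text{ correct on }(x,y)}p_{A,B}\Big)^{ -1}$, with $p$ ranging over probability distributions on pairs $(A,B)$ of deterministic strategies. Conventions: $1/0=+\infty$; a maximum over an empty set (constant $f$) is $0$. -}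

module Defs where

open import Data.Bool using (Bool; true; false)
import Data.Bool.Properties as Bool
open import Data.Fin using (Fin)
import Data.Fin.Properties as Fin
open import Data.List using (List; []; _∷_; map; foldr; filter; length; allFin;
  cartesianProduct; cartesianProductWith)
import Data.List as List
open import Data.Nat as ℕ using (ℕ; zero; suc; _⊔_)
import Data.Nat.Properties as ℕ
open import Data.Product using (Σ-syntax; ∃-syntax; _×_; _,_)
open import Data.Rational as ℚ using (ℚ; 0ℚ; 1ℚ; ∣_∣)
import Data.Rational.Properties as ℚ
open import Data.Vec using (Vec; []; _∷_; lookup)
open import Level using (0ℓ)
open import Relation.Binary.PropositionalEquality
  using (_≡_; _≢_; sym; trans; cong; subst)
open import Relation.Nullary using (Dec)
open import Relation.Nullary.Decidable using (¬?; _×-dec_; dec⇒maybe)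
open import Tactic.RingSolver using (solve-∀)
open import Tactic.RingSolver.Core.AlmostCommutativeRing
  using (AlmostCommutativeRing; fromCommutativeRing)

------------------------------------------------------------------------
-- Real numbers: Cauchy sequences of rationals

IsCauchy : (ℕ → ℚ) → Set
IsCauchy s = ∀ (ε : ℚ) → 0ℚ ℚ.< ε →
  ∃[ N ] (∀ m n → N ℕ.≤ m → N ℕ.≤ n → ∣ s m ℚ.- s n ∣ ℚ.≤ ε)

record ℝ : Set where
  constructor mkℝ
  field
    seq    : ℕ → ℚ
    cauchy : IsCauchy seq
open ℝ public

infix 4 _≤_ _≃_

_≤_ : ℝ → ℝ → Set
x ≤ y = ∀ (ε : ℚ) → 0ℚ ℚ.< ε →
  ∃[ N ] (∀ n → N ℕ.≤ n → seq x n ℚ.≤ seq y n ℚ.+ ε)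

_≃_ : ℝ → ℝ → Set
x ≃ y = x ≤ y × y ≤ x

-- The two abstract proofs would otherwise be unfolded by the positivity checks
-- of the records below, which then become prohibitively slow.
private
  ring : AlmostCommutativeRing 0ℓ 0ℓ
  ring = fromCommutativeRing ℚ.+-*-commutativeRing λ q → dec⇒maybe (0ℚ ℚ.≟ q)

  self-difference : ∀ q → ∣ q ℚ.- q ∣ ≡ 0ℚ
  self-difference q = cong ∣_∣ (ℚ.+-inverseʳ q)

  half-pos : ∀ {ε} → 0ℚ ℚ.< ε → 0ℚ ℚ.< ℚ.½ ℚ.* ε
  half-pos 0<ε = ℚ.*-monoʳ-<-pos ℚ.½ 0<ε

  halves : ∀ ε → ℚ.½ ℚ.* ε ℚ.+ ℚ.½ ℚ.* ε ≡ ε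
  halves ε = trans (sym (ℚ.*-distribʳ-+ ε ℚ.½ ℚ.½)) (ℚ.*-identityˡ ε)

  abstract
    +-cauchy : ∀ {s t} → IsCauchy s → IsCauchy t → IsCauchy (λ n → s n ℚ.+ t n)
    +-cauchy {s} {t} cs ct ε 0<ε
      with M , p ← cs (ℚ.½ ℚ.* ε) (half-pos 0<ε)
         | N , q ← ct (ℚ.½ ℚ.* ε) (half-pos 0<ε)
      = M ⊔ N , λ m n N≤m N≤n → begin
          ∣ (s m ℚ.+ t m) ℚ.- (s n ℚ.+ t n) ∣
            ≡⟨ cong ∣_∣ (rearrange (s m) (t m) (s n) (t n)) ⟩
          ∣ (s m ℚ.- s n) ℚ.+ (t m ℚ.- t n) ∣
            ≤⟨ ℚ.∣p+q∣≤∣p∣+∣q∣ (s m ℚ.- s n) (t m ℚ.- t n) ⟩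
          ∣ s m ℚ.- s n ∣ ℚ.+ ∣ t m ℚ.- t n ∣
            ≤⟨ ℚ.+-mono-≤
                 (p m n (ℕ.m⊔n≤o⇒m≤o M N N≤m) (ℕ.m⊔n≤o⇒m≤o M N N≤n))
                 (q m n (ℕ.m⊔n≤o⇒n≤o M N N≤m) (ℕ.m⊔n≤o⇒n≤o M N N≤n)) ⟩
          ℚ.½ ℚ.* ε ℚ.+ ℚ.½ ℚ.* ε
            ≡⟨ halves ε ⟩
          ε ∎
      where
      open ℚ.≤-Reasoning
      rearrange : ∀ a b c d → (a ℚ.+ b) ℚ.- (c ℚ.+ d) ≡ (a ℚ.- c) ℚ.+ (b ℚ.- d)
      rearrange = solve-∀ ring

  bounded : ∀ {s} → IsCauchy s →
            ∃[ B ] (0ℚ ℚ.< B × ∃[ N ] (∀ n → N ℕ.≤ n → ∣ s n ∣ ℚ.≤ B))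
  bounded {s} cs with N , p ← cs 1ℚ (ℚ.positive⁻¹ 1ℚ)
    = 1ℚ ℚ.+ ∣ s N ∣
    , ℚ.+-mono-<-≤ (ℚ.positive⁻¹ 1ℚ) (ℚ.0≤∣p∣ (s N))
    , N , λ n N≤n → begin
        ∣ s n ∣                        ≡⟨ cong ∣_∣ (split (s n) (s N)) ⟩
        ∣ (s n ℚ.- s N) ℚ.+ s N ∣      ≤⟨ ℚ.∣p+q∣≤∣p∣+∣q∣ (s n ℚ.- s N) (s N) ⟩
        ∣ s n ℚ.- s N ∣ ℚ.+ ∣ s N ∣    ≤⟨ ℚ.+-monoˡ-≤ ∣ s N ∣ (p n N N≤n ℕ.≤-refl) ⟩
        1ℚ ℚ.+ ∣ s N ∣ ∎
    where
    open ℚ.≤-Reasoning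
    split : ∀ a b → a ≡ (a ℚ.- b) ℚ.+ b
    split = solve-∀ ring

  ∣*∣-mono : ∀ {a b B δ} → 0ℚ ℚ.< B → ∣ a ∣ ℚ.≤ B → ∣ b ∣ ℚ.≤ δ →
             ∣ a ℚ.* b ∣ ℚ.≤ B ℚ.* δ
  ∣*∣-mono {a} {b} {B} {δ} 0<B a≤B b≤δ = begin
    ∣ a ℚ.* b ∣       ≡⟨ ℚ.∣p*q∣≡∣p∣*∣q∣ a b ⟩
    ∣ a ∣ ℚ.* ∣ b ∣   ≤⟨ ℚ.*-monoʳ-≤-nonNeg ∣ b ∣ {{ℚ.nonNegative (ℚ.0≤∣p∣ b)}} a≤B ⟩
    B ℚ.* ∣ b ∣       ≤⟨ ℚ.*-monoˡ-≤-nonNeg B {{ℚ.nonNegative (ℚ.<⇒≤ 0<B)}} b≤δ ⟩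
    B ℚ.* δ ∎
    where open ℚ.≤-Reasoning

  quotient : ∀ K ε → 0ℚ ℚ.< K → 0ℚ ℚ.< ε → ∃[ δ ] (0ℚ ℚ.< δ × K ℚ.* δ ≡ ε)
  quotient K ε 0<K 0<ε = ε ℚ.* r , 0<εr , Kεr≡ε
    where
    open ℚ.≤-Reasoning
    instance
      K-pos : ℚ.Positive K
      K-pos = ℚ.positive 0<K
      K≢0 : ℚ.NonZero K
      K≢0 = ℚ.pos⇒nonZero K
    r = ℚ.1/ K
    0<εr : 0ℚ ℚ.< ε ℚ.* r
    0<εr = ℚ.positive⁻¹ _ {{ℚ.pos*pos⇒pos ε {{ℚ.positive 0<ε}} r {{ℚ.1/pos⇒pos K}}}}
    swap : ∀ a b c → a ℚ.* (b ℚ.* c) ≡ b ℚ.* (a ℚ.* c)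
    swap = solve-∀ ring
    Kεr≡ε : K ℚ.* (ε ℚ.* r) ≡ ε
    Kεr≡ε = begin-equality
      K ℚ.* (ε ℚ.* r)   ≡⟨ swap K ε r ⟩
      ε ℚ.* (K ℚ.* r)   ≡⟨ cong (ε ℚ.*_) (ℚ.*-inverseʳ K) ⟩
      ε ℚ.* 1ℚ          ≡⟨ ℚ.*-identityʳ ε ⟩
      ε ∎

  abstract
    *-cauchy : ∀ {s t} → IsCauchy s → IsCauchy t → IsCauchy (λ n → s n ℚ.* t n)
    *-cauchy {s} {t} cs ct ε 0<ε =
      let B , 0<B , N₁ , p₁ = bounded {s} cs
          C , 0<C , N₂ , p₂ = bounded {t} ct
          δ , 0<δ , Kδ≡ε    = quotient (B ℚ.+ C) ε (ℚ.+-mono-< 0<B 0<C) 0<ε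
          M₁ , q₁           = cs δ 0<δ
          M₂ , q₂           = ct δ 0<δ
      in (N₁ ⊔ N₂) ⊔ (M₁ ⊔ M₂) , λ m n N≤m N≤n →
        let Nm = ℕ.m⊔n≤o⇒m≤o (N₁ ⊔ N₂) (M₁ ⊔ M₂) N≤m
            Nn = ℕ.m⊔n≤o⇒m≤o (N₁ ⊔ N₂) (M₁ ⊔ M₂) N≤n
            Mm = ℕ.m⊔n≤o⇒n≤o (N₁ ⊔ N₂) (M₁ ⊔ M₂) N≤m
            Mn = ℕ.m⊔n≤o⇒n≤o (N₁ ⊔ N₂) (M₁ ⊔ M₂) N≤n
        in product-bound {s m} {t m} {s n} {t n} 0<B 0<C Kδ≡ε
             (p₁ m (ℕ.m⊔n≤o⇒m≤o N₁ N₂ Nm))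
             (p₂ n (ℕ.m⊔n≤o⇒n≤o N₁ N₂ Nn))
             (q₁ m n (ℕ.m⊔n≤o⇒m≤o M₁ M₂ Mm) (ℕ.m⊔n≤o⇒m≤o M₁ M₂ Mn))
             (q₂ m n (ℕ.m⊔n≤o⇒n≤o M₁ M₂ Mm) (ℕ.m⊔n≤o⇒n≤o M₁ M₂ Mn))
      where
      open ℚ.≤-Reasoning
      rearrange : ∀ a b c d →
        a ℚ.* b ℚ.- c ℚ.* d ≡ a ℚ.* (b ℚ.- d) ℚ.+ d ℚ.* (a ℚ.- c)
      rearrange = solve-∀ ring
      product-bound : ∀ {a b c d B C δ ε} → 0ℚ ℚ.< B → 0ℚ ℚ.< C →
        (B ℚ.+ C) ℚ.* δ ≡ ε → ∣ a ∣ ℚ.≤ B → ∣ d ∣ ℚ.≤ C →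
        ∣ a ℚ.- c ∣ ℚ.≤ δ → ∣ b ℚ.- d ∣ ℚ.≤ δ → ∣ a ℚ.* b ℚ.- c ℚ.* d ∣ ℚ.≤ ε
      product-bound {a} {b} {c} {d} {B} {C} {δ} {ε} 0<B 0<C Kδ≡ε a≤B d≤C ac≤δ bd≤δ = begin
        ∣ a ℚ.* b ℚ.- c ℚ.* d ∣
          ≡⟨ cong ∣_∣ (rearrange a b c d) ⟩
        ∣ a ℚ.* (b ℚ.- d) ℚ.+ d ℚ.* (a ℚ.- c) ∣
          ≤⟨ ℚ.∣p+q∣≤∣p∣+∣q∣ (a ℚ.* (b ℚ.- d)) (d ℚ.* (a ℚ.- c)) ⟩
        ∣ a ℚ.* (b ℚ.- d) ∣ ℚ.+ ∣ d ℚ.* (a ℚ.- c) ∣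
          ≤⟨ ℚ.+-mono-≤ (∣*∣-mono {a} {b ℚ.- d} 0<B a≤B bd≤δ)
                        (∣*∣-mono {d} {a ℚ.- c} 0<C d≤C ac≤δ) ⟩
        B ℚ.* δ ℚ.+ C ℚ.* δ
          ≡⟨ ℚ.*-distribʳ-+ δ B C ⟨
        (B ℚ.+ C) ℚ.* δ
          ≡⟨ Kδ≡ε ⟩
        ε ∎

fromℚ : ℚ → ℝ
fromℚ q = mkℝ (λ _ → q) λ ε 0<ε → 0 , λ _ _ _ _ →
  subst (ℚ._≤ ε) (sym (self-difference q)) (ℚ.<⇒≤ 0<ε)

0ℝ 1ℝ : ℝ
0ℝ = fromℚ 0ℚ
1ℝ = fromℚ 1ℚ

infixl 6 _+_
infixl 7 _*_

_+_ _*_ : ℝ → ℝ → ℝ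
x + y = mkℝ (λ n → seq x n ℚ.+ seq y n) (+-cauchy {seq x} {seq y} (cauchy x) (cauchy y))
x * y = mkℝ (λ n → seq x n ℚ.* seq y n) (*-cauchy {seq x} {seq y} (cauchy x) (cauchy y))

∑ : {A : Set} → List A → (A → ℝ) → ℝ
∑ xs g = foldr _+_ 0ℝ (map g xs)

------------------------------------------------------------------------
-- Extended reals

-- An extended real a is given by its set of real upper bounds: a t is read
-- "a ≤ t".  The value +∞ is the empty set.
ℝ∞ : Set₁
ℝ∞ = ℝ → Set

infix 4 _≤∞_

_≤∞_ : ℝ∞ → ℝ∞ → Set
a ≤∞ b = ∀ t → b t → a t

-- The inverse of a real w ≥ 0.  For w > 0, w ⁻¹ ≤ t means 1 ≤ t w; for w = 0
-- there is no such t, so the value is +∞.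
_⁻¹ : ℝ → ℝ∞
(w ⁻¹) t = 0ℝ ≤ t × 1ℝ ≤ t * w

-- The maximum of a family of values in [0,+∞], which is 0 for the empty family.
maximum : {I : Set} → (I → ℝ∞) → ℝ∞
maximum {I} a t = 0ℝ ≤ t × (∀ (i : I) → a i t)

-- As for any attained minimum, min a ≤ t holds iff some member of the family
-- is ≤ t.  The minima used below are attained: strategies form a compact set on
-- which the objective is continuous with values in [0,+∞].
minimum : {I : Set} → (I → ℝ∞) → ℝ∞
minimum {I} a t = Σ[ i ∈ I ] a i t

infixr 7 _·_
infix  8 _³

-- Scaling by a real c ≥ 0, and the cube of a value in [0,+∞].  Both maps are
-- monotone, so the image of a is below t iff the image of some real u ≥ a is.
_·_ : ℝ → ℝ∞ → ℝ∞
(c · a) t = Σ[ u ∈ ℝ ] (a u × c * u ≤ t)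

_³ : ℝ∞ → ℝ∞
(a ³) t = Σ[ u ∈ ℝ ] (a u × u * u * u ≤ t)

------------------------------------------------------------------------
-- Boolean functions

BoolFun : ℕ → Set
BoolFun n = Vec Bool n → Bool

allVecs : {A : Set} → List A → ∀ k → List (Vec A k)
allVecs xs zero    = [] ∷ []
allVecs xs (suc k) = cartesianProductWith _∷_ xs (allVecs xs k)

preimage : ∀ {n} → BoolFun n → Bool → List (Vec Bool n)
preimage {n} f b = filter (λ x → f x Bool.≟ b) (allVecs (false ∷ true ∷ []) n)

-- f⁻¹(b) as a finite type, with its elements numbered by their position in
-- the enumeration, which is free of repetitions.
Preimage : ∀ {n} → BoolFun n → Bool → Set
Preimage f b = Fin (length (preimage f b))

input : ∀ {n} (f : BoolFun n) b → Preimage f b → Vec Bool n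
input f b = List.lookup (preimage f b)

differing : ∀ {n} → Vec Bool n → Vec Bool n → List (Fin n)
differing {n} x y = filter (λ i → ¬? (lookup x i Bool.≟ lookup y i)) (allFin n)

record IsDistribution {A : Set} (support : List A) (p : A → ℝ) : Set where
  field
    nonNegative : ∀ a → 0ℝ ≤ p a
    total       : ∑ support p ≃ 1ℝ

------------------------------------------------------------------------
-- Private coins

record PrivateStrategy (n : ℕ) : Set where
  field
    prob           : Vec Bool n → Fin n → ℝ
    isDistribution : ∀ x → IsDistribution (allFin n) (prob x)

privateWin : ∀ {n} → PrivateStrategy n → Vec Bool n → Vec Bool n → ℝ
privateWin p x y = ∑ (differing x y) (λ i → prob x i * prob y i)
  where open PrivateStrategy p

CGpriv : ∀ {n} → BoolFun n → ℝ∞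
CGpriv {n} f =
  minimum λ (p : PrivateStrategy n) →
  maximum λ ((x , y) : Preimage f false × Preimage f true) →
  privateWin p (input f false x) (input f true y) ⁻¹

------------------------------------------------------------------------
-- Public coins

-- A map f⁻¹(b) → [n], as the table of its values.
Strategy : ∀ {n} → BoolFun n → Bool → Set
Strategy {n} f b = Vec (Fin n) (length (preimage f b))

StrategyPair : ∀ {n} → BoolFun n → Set
StrategyPair f = Strategy f false × Strategy f true

strategyPairs : ∀ {n} (f : BoolFun n) → List (StrategyPair f)
strategyPairs {n} f = cartesianProduct (allVecs (allFin n) _) (allVecs (allFin n) _)

Correct : ∀ {n} (f : BoolFun n) → Preimage f false → Preimage f true →
          StrategyPair f → Set
Correct f x y (A , B) =
  lookup A x ≡ lookup B y ×
  lookup (input f false x) (lookup A x) ≢ lookup (input f true y) (lookup A x)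

correct? : ∀ {n} (f : BoolFun n) x y (AB : StrategyPair f) → Dec (Correct f x y AB)
correct? f x y (A , B) =
  (lookup A x Fin.≟ lookup B y) ×-dec
  ¬? (lookup (input f false x) (lookup A x) Bool.≟ lookup (input f true y) (lookup A x))

record PublicStrategy {n} (f : BoolFun n) : Set where
  field
    prob           : StrategyPair f → ℝ
    isDistribution : IsDistribution (strategyPairs f) prob

publicWin : ∀ {n} (f : BoolFun n) → PublicStrategy f →
            Preimage f false → Preimage f true → ℝ
publicWin f p x y = ∑ (filter (correct? f x y) (strategyPairs f)) prob
  where open PublicStrategy p

CGpub : ∀ {n} → BoolFun n → ℝ∞
CGpub f =
  minimum λ (p : PublicStrategy f) →
  maximum λ ((x , y) : Preimage f false × Preimage f true) →
  publicWin f p x y ⁻¹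

module Submission where

-- For the first inequality, players holding public coins sample, independently for every
-- input, an answer from its private-coin distribution.
--
-- For the second, let q x be the distribution of the answer on input x under a public
-- strategy that wins with probability at least θ everywhere. Then q x gives weight at
-- least θ to every sensitive block of x, and in particular to every sensitive bit. So if
-- B is a minimal sensitive block of x and z is x with B flipped, each bit of B has weight
-- at least θ under q z, whence |B| ≤ 1/θ, and truncating q x to 0 below θ²/2 leaves weight
-- at least θ/2 on B. Let r be the truncated weights. Given x and y with different values,
-- splice them bitwise so that the result differs from each only where that one has the
-- smaller weight; the value of f at the splice shows that the sum of min (r x i) (r y i)
-- over the differing bits is at least θ/2. As nonzero weights are at least θ²/2, the sum of
-- r x i * r y i is at least θ³/4.
--
-- Truncation is discontinuous, so the second argument runs on a rational approximation of
-- the public strategy, at the price of a larger constant.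

open import Defs
open import Data.Bool using (Bool; true; false)
import Data.Bool.Properties as Bool
open import Data.Empty using (⊥-elim)
open import Data.Fin using (Fin; zero; suc)
import Data.Fin.Properties as Fin
open import Data.Integer using (+_)
open import Data.List using (List; []; _∷_; _++_; map; filter; allFin; cartesianProductWith)
import Data.List.Properties as List
open import Data.List.Membership.Propositional using (_∈_)
open import Data.List.Membership.Propositional.Properties
  using (∈-cartesianProductWith⁺; ∈-filter⁺; ∈-filter⁻; ∈-lookup)
open import Data.List.Relation.Unary.Any using (here; there; index)
open import Data.List.Relation.Unary.Any.Properties using (lookup-index)
open import Data.Nat as ℕ using (ℕ; zero; suc)
import Data.Nat.Properties as ℕ
open import Data.Product using (Σ-syntax; ∃-syntax; _×_; _,_; proj₁; proj₂)
open import Data.Rational as ℚ using (ℚ; 0ℚ; 1ℚ; ½; ∣_∣)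
import Data.Rational.Properties as ℚ
open import Data.Sum using (inj₁; inj₂)
open import Data.Vec as Vec using (Vec; []; _∷_; lookup; _[_]≔_)
import Data.Vec.Functional as Vector
import Data.Vec.Properties as Vec
open import Function using (_∘_)
open import Level using (0ℓ)
open import Relation.Binary.PropositionalEquality
  using (_≡_; _≢_; refl; sym; trans; cong; cong₂; subst; subst₂; module ≡-Reasoning)
open import Relation.Nullary using (Dec; yes; no; ¬_)
open import Relation.Nullary.Decidable using (¬?; _×-dec_; dec⇒maybe; decidable-stable)
open import Relation.Unary using (Decidable)
open import Tactic.RingSolver using (solve-∀)
open import Tactic.RingSolver.Core.AlmostCommutativeRing
  using (AlmostCommutativeRing; fromCommutativeRing)

-- Rational arithmetic

ring : AlmostCommutativeRing 0ℓ 0ℓ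
ring = fromCommutativeRing ℚ.+-*-commutativeRing λ q → dec⇒maybe (0ℚ ℚ.≟ q)

-- Polynomial inequalities below are proved by certificates: the difference of the two sides is
-- written as a sum of products of nonnegative terms, and the ring solver checks the identity.
≤-by : ∀ {a b} d → 0ℚ ℚ.≤ d → b ≡ a ℚ.+ d → a ℚ.≤ b
≤-by {a} {b} d 0≤d b≡a+d = begin
  a            ≡⟨ ℚ.+-identityʳ a ⟨
  a ℚ.+ 0ℚ     ≤⟨ ℚ.+-monoʳ-≤ a 0≤d ⟩
  a ℚ.+ d      ≡⟨ b≡a+d ⟨
  b            ∎
  where open ℚ.≤-Reasoning

0≤a-b : ∀ {a b} → b ℚ.≤ a → 0ℚ ℚ.≤ a ℚ.- b
0≤a-b {a} {b} b≤a = subst (ℚ._≤ a ℚ.- b) (ℚ.+-inverseʳ b) (ℚ.+-monoˡ-≤ (ℚ.- b) b≤a)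

*-monoˡ : ∀ {c a b} → 0ℚ ℚ.≤ c → a ℚ.≤ b → c ℚ.* a ℚ.≤ c ℚ.* b
*-monoˡ {c} 0≤c = ℚ.*-monoˡ-≤-nonNeg c {{ℚ.nonNegative 0≤c}}

*-monoʳ : ∀ {c a b} → 0ℚ ℚ.≤ c → a ℚ.≤ b → a ℚ.* c ℚ.≤ b ℚ.* c
*-monoʳ {c} 0≤c = ℚ.*-monoʳ-≤-nonNeg c {{ℚ.nonNegative 0≤c}}

0≤a*b : ∀ {a b} → 0ℚ ℚ.≤ a → 0ℚ ℚ.≤ b → 0ℚ ℚ.≤ a ℚ.* b
0≤a*b {a} {b} 0≤a 0≤b = subst (ℚ._≤ a ℚ.* b) (ℚ.*-zeroʳ a) (*-monoˡ 0≤a 0≤b)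

0≤a+b : ∀ {a b} → 0ℚ ℚ.≤ a → 0ℚ ℚ.≤ b → 0ℚ ℚ.≤ a ℚ.+ b
0≤a+b {a} {b} 0≤a 0≤b = ℚ.+-mono-≤ 0≤a 0≤b

0≤1 : 0ℚ ℚ.≤ 1ℚ
0≤1 = ℚ.nonNegative⁻¹ 1ℚ

0≤½ : 0ℚ ℚ.≤ ½
0≤½ = ℚ.nonNegative⁻¹ ½

-- Indicators and finite sums

𝟙 : {P : Set} → Dec P → ℚ
𝟙 (yes _) = 1ℚ
𝟙 (no _)  = 0ℚ

0≤𝟙 : {P : Set} (P? : Dec P) → 0ℚ ℚ.≤ 𝟙 P?
0≤𝟙 (yes _) = 0≤1
0≤𝟙 (no _)  = ℚ.≤-refl

𝟙≤1 : {P : Set} (P? : Dec P) → 𝟙 P? ℚ.≤ 1ℚ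
𝟙≤1 (yes _) = ℚ.≤-refl
𝟙≤1 (no _)  = 0≤1

𝟙-cong : {P Q : Set} (P? : Dec P) (Q? : Dec Q) → (P → Q) → (Q → P) → 𝟙 P? ≡ 𝟙 Q?
𝟙-cong (yes _) (yes _) _ _ = refl
𝟙-cong (yes p) (no ¬q) f _ = ⊥-elim (¬q (f p))
𝟙-cong (no ¬p) (yes q) _ g = ⊥-elim (¬p (g q))
𝟙-cong (no _)  (no _)  _ _ = refl

𝟙*-mono : {P Q : Set} (P? : Dec P) (Q? : Dec Q) → ∀ {a b} →
  (P → Q) → (Q → 0ℚ ℚ.≤ b) → (P → a ℚ.≤ b) → 𝟙 P? ℚ.* a ℚ.≤ 𝟙 Q? ℚ.* b
𝟙*-mono (yes p) (yes q) {a} {b} P⇒Q 0≤b a≤b =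
  subst₂ ℚ._≤_ (sym (ℚ.*-identityˡ a)) (sym (ℚ.*-identityˡ b)) (a≤b p)
𝟙*-mono (yes p) (no ¬q)  P⇒Q 0≤b a≤b = ⊥-elim (¬q (P⇒Q p))
𝟙*-mono (no _)  (yes q) {a} {b} P⇒Q 0≤b a≤b =
  subst₂ ℚ._≤_ (sym (ℚ.*-zeroˡ a)) (sym (ℚ.*-identityˡ b)) (0≤b q)
𝟙*-mono (no _)  (no _) {a} {b} P⇒Q 0≤b a≤b =
  ℚ.≤-reflexive (trans (ℚ.*-zeroˡ a) (sym (ℚ.*-zeroˡ b)))

sum : {A : Set} → List A → (A → ℚ) → ℚ
sum []       g = 0ℚ
sum (x ∷ xs) g = g x ℚ.+ sum xs g

seq-∑ : {A : Set} (xs : List A) (g : A → ℝ) (n : ℕ) →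
  seq (∑ xs g) n ≡ sum xs (λ a → seq (g a) n)
seq-∑ []       g n = refl
seq-∑ (x ∷ xs) g n = cong (seq (g x) n ℚ.+_) (seq-∑ xs g n)

module _ {A : Set} where

  sum-cong : ∀ (xs : List A) {g h} → (∀ a → g a ≡ h a) → sum xs g ≡ sum xs h
  sum-cong []       e = refl
  sum-cong (x ∷ xs) e = cong₂ ℚ._+_ (e x) (sum-cong xs e)

  sum-mono : ∀ (xs : List A) {g h} → (∀ a → g a ℚ.≤ h a) → sum xs g ℚ.≤ sum xs h
  sum-mono []       e = ℚ.≤-refl
  sum-mono (x ∷ xs) e = ℚ.+-mono-≤ (e x) (sum-mono xs e)

  sum-zero : ∀ (xs : List A) → sum xs (λ _ → 0ℚ) ≡ 0ℚ
  sum-zero []       = refl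
  sum-zero (x ∷ xs) = trans (ℚ.+-identityˡ _) (sum-zero xs)

  sum-nonNeg : ∀ (xs : List A) {g} → (∀ a → 0ℚ ℚ.≤ g a) → 0ℚ ℚ.≤ sum xs g
  sum-nonNeg []       e = ℚ.≤-refl
  sum-nonNeg (x ∷ xs) e = 0≤a+b (e x) (sum-nonNeg xs e)

  sum-distrib-+ : ∀ (xs : List A) g h →
    sum xs (λ a → g a ℚ.+ h a) ≡ sum xs g ℚ.+ sum xs h
  sum-distrib-+ []       g h = refl
  sum-distrib-+ (x ∷ xs) g h =
    trans (cong (g x ℚ.+ h x ℚ.+_) (sum-distrib-+ xs g h))
          (interchange (g x) (h x) (sum xs g) (sum xs h))
    where
    interchange : ∀ a b c d → a ℚ.+ b ℚ.+ (c ℚ.+ d) ≡ a ℚ.+ c ℚ.+ (b ℚ.+ d)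
    interchange = solve-∀ ring

  *-distribˡ-sum : ∀ c (xs : List A) g → sum xs (λ a → c ℚ.* g a) ≡ c ℚ.* sum xs g
  *-distribˡ-sum c []       g = sym (ℚ.*-zeroʳ c)
  *-distribˡ-sum c (x ∷ xs) g =
    trans (cong (c ℚ.* g x ℚ.+_) (*-distribˡ-sum c xs g))
          (sym (ℚ.*-distribˡ-+ c (g x) (sum xs g)))

  *-distribʳ-sum : ∀ c (xs : List A) g → sum xs (λ a → g a ℚ.* c) ≡ sum xs g ℚ.* c
  *-distribʳ-sum c xs g =
    trans (sum-cong xs λ a → ℚ.*-comm (g a) c)
          (trans (*-distribˡ-sum c xs g) (ℚ.*-comm c (sum xs g)))

  sum-++ : ∀ (xs ys : List A) g → sum (xs ++ ys) g ≡ sum xs g ℚ.+ sum ys g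
  sum-++ []       ys g = sym (ℚ.+-identityˡ _)
  sum-++ (x ∷ xs) ys g =
    trans (cong (g x ℚ.+_) (sum-++ xs ys g)) (sym (ℚ.+-assoc (g x) _ _))

  -- Trades a filtered sum for an indicator-weighted sum over the whole list, where sums can be
  -- interchanged and compared term by term.
  sum-filter : {P : A → Set} (P? : Decidable P) (xs : List A) (g : A → ℚ) →
    sum (filter P? xs) g ≡ sum xs (λ a → 𝟙 (P? a) ℚ.* g a)
  sum-filter P? []       g = refl
  sum-filter P? (x ∷ xs) g with P? x
  ... | yes _ = cong₂ ℚ._+_ (sym (ℚ.*-identityˡ (g x))) (sum-filter P? xs g)
  ... | no  _ = trans (sum-filter P? xs g)
                      (sym (trans (cong (ℚ._+ _) (ℚ.*-zeroˡ (g x))) (ℚ.+-identityˡ _)))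

module _ {A B : Set} where

  sum-map : (f : A → B) (xs : List A) (g : B → ℚ) → sum (map f xs) g ≡ sum xs (g ∘ f)
  sum-map f []       g = refl
  sum-map f (x ∷ xs) g = cong (g (f x) ℚ.+_) (sum-map f xs g)

  sum-swap : (xs : List A) (ys : List B) (g : A → B → ℚ) →
    sum xs (λ a → sum ys (g a)) ≡ sum ys (λ b → sum xs (λ a → g a b))
  sum-swap []       ys g = sym (sum-zero ys)
  sum-swap (x ∷ xs) ys g =
    trans (cong (sum ys (g x) ℚ.+_) (sum-swap xs ys g))
          (sym (sum-distrib-+ ys (g x) (λ b → sum xs (λ a → g a b))))

sum-cartesianProductWith : {A B C : Set} (f : A → B → C) (xs : List A) (ys : List B) (g : C → ℚ) →
  sum (cartesianProductWith f xs ys) g ≡ sum xs (λ a → sum ys (λ b → g (f a b)))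
sum-cartesianProductWith f []       ys g = refl
sum-cartesianProductWith f (x ∷ xs) ys g =
  trans (sum-++ (map (f x) ys) _ g)
        (cong₂ ℚ._+_ (sum-map (f x) ys g) (sum-cartesianProductWith f xs ys g))

sum-allFin-suc : ∀ n (g : Fin (suc n) → ℚ) →
  sum (allFin (suc n)) g ≡ g zero ℚ.+ sum (allFin n) (g ∘ suc)
sum-allFin-suc n g = cong (g zero ℚ.+_)
  (trans (cong (λ is → sum is g) (sym (List.map-tabulate (λ i → i) suc)))
         (sum-map suc (allFin n) g))

sum-δ : ∀ {n} (i : Fin n) (g : Fin n → ℚ) →
  sum (allFin n) (λ j → 𝟙 (i Fin.≟ j) ℚ.* g j) ≡ g i
sum-δ {suc n} zero g = begin
  sum (allFin (suc n)) (λ j → 𝟙 (zero Fin.≟ j) ℚ.* g j)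
    ≡⟨ sum-allFin-suc n (λ j → 𝟙 (zero Fin.≟ j) ℚ.* g j) ⟩
  1ℚ ℚ.* g zero ℚ.+ sum (allFin n) (λ j → 0ℚ ℚ.* g (suc j))
    ≡⟨ cong₂ ℚ._+_ (ℚ.*-identityˡ (g zero))
         (trans (sum-cong (allFin n) λ j → ℚ.*-zeroˡ (g (suc j))) (sum-zero (allFin n))) ⟩
  g zero ℚ.+ 0ℚ
    ≡⟨ ℚ.+-identityʳ (g zero) ⟩
  g zero ∎
  where open ≡-Reasoning
sum-δ {suc n} (suc i) g = begin
  sum (allFin (suc n)) (λ j → 𝟙 (suc i Fin.≟ j) ℚ.* g j)
    ≡⟨ sum-allFin-suc n (λ j → 𝟙 (suc i Fin.≟ j) ℚ.* g j) ⟩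
  0ℚ ℚ.* g zero ℚ.+ sum (allFin n) (λ j → 𝟙 (suc i Fin.≟ suc j) ℚ.* g (suc j))
    ≡⟨ cong₂ ℚ._+_ (ℚ.*-zeroˡ (g zero))
         (sum-cong (allFin n) λ j → cong (ℚ._* g (suc j))
            (𝟙-cong (suc i Fin.≟ suc j) (i Fin.≟ j) Fin.suc-injective (cong suc))) ⟩
  0ℚ ℚ.+ sum (allFin n) (λ j → 𝟙 (i Fin.≟ j) ℚ.* g (suc j))
    ≡⟨ ℚ.+-identityˡ _ ⟩
  sum (allFin n) (λ j → 𝟙 (i Fin.≟ j) ℚ.* g (suc j))
    ≡⟨ sum-δ i (g ∘ suc) ⟩
  g (suc i) ∎
  where open ≡-Reasoning

-- Sums over differing coordinates

sum-differing-mono : ∀ {n} (x y x′ y′ : Vec Bool n) {g h : Fin n → ℚ} →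
  (∀ i → 0ℚ ℚ.≤ h i) →
  (∀ i → lookup x i ≢ lookup y i → lookup x′ i ≢ lookup y′ i × g i ℚ.≤ h i) →
  sum (differing x y) g ℚ.≤ sum (differing x′ y′) h
sum-differing-mono {n} x y x′ y′ 0≤h le =
  subst₂ ℚ._≤_ (sym (sum-filter _ (allFin n) _)) (sym (sum-filter _ (allFin n) _))
    (sum-mono (allFin n) λ i →
      𝟙*-mono (¬? (lookup x i Bool.≟ lookup y i)) (¬? (lookup x′ i Bool.≟ lookup y′ i))
        (λ d → proj₁ (le i d)) (λ _ → 0≤h i) (λ d → proj₂ (le i d)))

sum-differing≤sum : ∀ {n} (x y : Vec Bool n) {g : Fin n → ℚ} → (∀ i → 0ℚ ℚ.≤ g i) →
  sum (differing x y) g ℚ.≤ sum (allFin n) g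
sum-differing≤sum {n} x y {g} 0≤g =
  subst (ℚ._≤ _) (sym (sum-filter _ (allFin n) g)) (sum-mono (allFin n) λ i →
    ℚ.≤-trans (*-monoʳ (0≤g i) (𝟙≤1 (¬? (lookup x i Bool.≟ lookup y i))))
              (ℚ.≤-reflexive (ℚ.*-identityˡ (g i))))

-- No coordinate but `i` can contribute. The bound is an inequality because writing `b` may leave
-- the bit as it was.
sum-differing-update : ∀ {n} (z : Vec Bool n) i b {g : Fin n → ℚ} → (∀ i → 0ℚ ℚ.≤ g i) →
  sum (differing z (z [ i ]≔ b)) g ℚ.≤ g i
sum-differing-update {n} z i b {g} 0≤g =
  subst₂ ℚ._≤_ (sym (sum-filter _ (allFin n) g)) (sum-δ i g) (sum-mono (allFin n) λ j →
    𝟙*-mono (¬? (lookup z j Bool.≟ lookup (z [ i ]≔ b) j)) (i Fin.≟ j)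
      (differ⇒≡ j) (λ _ → 0≤g j) (λ _ → ℚ.≤-refl))
  where
  differ⇒≡ : ∀ j → lookup z j ≢ lookup (z [ i ]≔ b) j → i ≡ j
  differ⇒≡ j d with i Fin.≟ j
  ... | yes i≡j = i≡j
  ... | no  i≢j = ⊥-elim (d (sym (Vec.lookup∘update′ (i≢j ∘ sym) z b)))

-- Minimal sensitive blocks

bitDistance : Bool → Bool → ℕ
bitDistance a b with a Bool.≟ b
... | yes _ = 0
... | no  _ = 1

bitDistance-≡ : ∀ a → bitDistance a a ≡ 0
bitDistance-≡ a with a Bool.≟ a
... | yes _   = refl
... | no  a≢a = ⊥-elim (a≢a refl)

bitDistance-≢ : ∀ {a b} → a ≢ b → bitDistance a b ≡ 1
bitDistance-≢ {a} {b} a≢b with a Bool.≟ b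
... | yes a≡b = ⊥-elim (a≢b a≡b)
... | no  _   = refl

hamming : ∀ {n} → Vec Bool n → Vec Bool n → ℕ
hamming []      []      = 0
hamming (a ∷ x) (b ∷ y) = bitDistance a b ℕ.+ hamming x y

-- Supplies the decreasing measure for the search in `minimalBlock`.
hamming-update : ∀ {n} (x y : Vec Bool n) i → lookup x i ≢ lookup y i →
  hamming x y ≡ suc (hamming x (y [ i ]≔ lookup x i))
hamming-update (a ∷ x) (b ∷ y) zero    a≢b =
  trans (cong (ℕ._+ hamming x y) (bitDistance-≢ a≢b))
        (cong (λ d → suc (d ℕ.+ hamming x y)) (sym (bitDistance-≡ a)))
hamming-update (a ∷ x) (b ∷ y) (suc i) d =
  trans (cong (bitDistance a b ℕ.+_) (hamming-update x y i d)) (ℕ.+-suc (bitDistance a b) _)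

-- The block is the set of coordinates where `x` and `flipped` differ, so it is stored as the
-- flipped input. Minimality undoes one flip at a time, which makes each coordinate of the block
-- sensitive at `flipped`.
record MinimalBlock {n} (f : BoolFun n) (x y : Vec Bool n) : Set where
  field
    flipped   : Vec Bool n
    sensitive : f flipped ≢ f x
    between   : ∀ i → lookup x i ≢ lookup flipped i → lookup x i ≢ lookup y i
    minimal   : ∀ i → lookup x i ≢ lookup flipped i → f (flipped [ i ]≔ lookup x i) ≡ f x

-- Greedy: flips are undone one by one as long as the value still differs from `f x`. The bound `m`
-- on the Hamming distance makes the recursion structural.
minimalBlock : ∀ {n} (f : BoolFun n) x y → f y ≢ f x → MinimalBlock f x y
minimalBlock {n} f x y = go (hamming x y) y ℕ.≤-refl
  where
  go : ∀ m y → hamming x y ℕ.≤ m → f y ≢ f x → MinimalBlock f x y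
  go m y h≤m fy≢fx with Fin.any? (λ i →
    ¬? (lookup x i Bool.≟ lookup y i) ×-dec ¬? (f (y [ i ]≔ lookup x i) Bool.≟ f x))
  go m y h≤m fy≢fx | no none = record
    { flipped   = y
    ; sensitive = fy≢fx
    ; between   = λ _ d → d
    ; minimal   = λ i d → decidable-stable (_ Bool.≟ _) λ ≢fx → none (i , d , ≢fx)
    }
  go zero y h≤m fy≢fx | yes (i , d , _) =
    ⊥-elim (ℕ.n≮0 (subst (ℕ._≤ 0) (hamming-update x y i d) h≤m))
  go (suc m) y h≤m fy≢fx | yes (i , d , ≢fx) = record
    { flipped   = flipped
    ; sensitive = sensitive
    ; between   = between′
    ; minimal   = minimal
    }
    where
    open MinimalBlock (go m (y [ i ]≔ lookup x i)
      (ℕ.≤-pred (subst (ℕ._≤ suc m) (hamming-update x y i d) h≤m)) ≢fx)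
    between′ : ∀ j → lookup x j ≢ lookup flipped j → lookup x j ≢ lookup y j
    between′ j d′ x≡y with j Fin.≟ i
    ... | yes refl = d x≡y
    ... | no  j≢i  = between j d′ (trans x≡y (sym (Vec.lookup∘update′ j≢i y (lookup x i))))

-- From covering weights to private strategies

-- A sensitive block of `x` is named by the input `y` reached by flipping it. For positive `θ` and
-- nonnegative `w`, dividing `w x` by `θ` gives a fractional certificate of `x`.
Covers : ∀ {n} → BoolFun n → ℚ → (Vec Bool n → Fin n → ℚ) → Set
Covers f θ w = ∀ x y → f y ≢ f x → θ ℚ.≤ sum (differing x y) (w x)

truncate : ℚ → ℚ → ℚ
truncate c q with c ℚ.≤? q
... | yes _ = q
... | no  _ = 0ℚ

module _ (c : ℚ) {q : ℚ} (0≤q : 0ℚ ℚ.≤ q) where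

  truncate-nonNeg : 0ℚ ℚ.≤ truncate c q
  truncate-nonNeg with c ℚ.≤? q
  ... | yes _ = 0≤q
  ... | no  _ = ℚ.≤-refl

  truncate≤ : truncate c q ℚ.≤ q
  truncate≤ with c ℚ.≤? q
  ... | yes _ = ℚ.≤-refl
  ... | no  _ = 0≤q

  ≤truncate+c : 0ℚ ℚ.≤ c → q ℚ.≤ truncate c q ℚ.+ c
  ≤truncate+c 0≤c with c ℚ.≤? q
  ... | yes _   = ≤-by c 0≤c refl
  ... | no  c≰q = ℚ.≤-trans (ℚ.<⇒≤ (ℚ.≰⇒> c≰q)) (ℚ.≤-reflexive (sym (ℚ.+-identityˡ c)))

-- If both values survive, one factor is at least `c` and the other is at least the minimum. If one
-- is cut to 0, the minimum is 0 as well.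
c*⊓≤*-truncate : ∀ c {q q′} → 0ℚ ℚ.≤ c → 0ℚ ℚ.≤ q → 0ℚ ℚ.≤ q′ →
  c ℚ.* (truncate c q ℚ.⊓ truncate c q′) ℚ.≤ truncate c q ℚ.* truncate c q′
c*⊓≤*-truncate c {q} {q′} 0≤c 0≤q 0≤q′ with c ℚ.≤? q | c ℚ.≤? q′
... | yes c≤q | yes c≤q′ = ℚ.≤-trans (*-monoˡ 0≤c (ℚ.p⊓q≤q q q′)) (*-monoʳ 0≤q′ c≤q)
... | yes _   | no  _    = ℚ.≤-trans (*-monoˡ 0≤c (ℚ.p⊓q≤q q 0ℚ))
  (ℚ.≤-reflexive (trans (ℚ.*-zeroʳ c) (sym (ℚ.*-zeroʳ q))))
... | no  _   | yes _    = ℚ.≤-trans (*-monoˡ 0≤c (ℚ.p⊓q≤p 0ℚ q′))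
  (ℚ.≤-reflexive (trans (ℚ.*-zeroʳ c) (sym (ℚ.*-zeroˡ q′))))
... | no  _   | no  _    = ℚ.≤-reflexive (ℚ.*-zeroʳ c)

module _ {n} (f : BoolFun n) {θ : ℚ} (0≤θ : 0ℚ ℚ.≤ θ) {q : Vec Bool n → Fin n → ℚ}
  (0≤q : ∀ x i → 0ℚ ℚ.≤ q x i) (∑q≤1 : ∀ x → sum (allFin n) (q x) ℚ.≤ 1ℚ)
  (covers : Covers f θ q) where

  private
    threshold : ℚ
    threshold = ½ ℚ.* θ ℚ.* θ

    0≤threshold : 0ℚ ℚ.≤ threshold
    0≤threshold = 0≤a*b (0≤a*b 0≤½ 0≤θ) 0≤θ

    r : Vec Bool n → Fin n → ℚ
    r x i = truncate threshold (q x i)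

    0≤r : ∀ x i → 0ℚ ℚ.≤ r x i
    0≤r x i = truncate-nonNeg threshold (0≤q x i)

  -- After flipping a minimal block, each of its coordinates is sensitive and so
  -- has weight at least θ; hence the block has at most 1/θ coordinates.
  minimalBlock-small : ∀ {x y} (β : MinimalBlock f x y) →
    sum (differing x (MinimalBlock.flipped β)) (λ _ → θ) ℚ.≤ 1ℚ
  minimalBlock-small {x} {y} β = begin
    sum (differing x z) (λ _ → θ)
      ≤⟨ sum-differing-mono x z x z (0≤q z) (λ i d → d , θ≤qz i d) ⟩
    sum (differing x z) (q z)    ≤⟨ sum-differing≤sum x z (0≤q z) ⟩
    sum (allFin n) (q z)         ≤⟨ ∑q≤1 z ⟩
    1ℚ                           ∎
    where
    open ℚ.≤-Reasoning
    open MinimalBlock β renaming (flipped to z)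
    θ≤qz : ∀ i → lookup x i ≢ lookup z i → θ ℚ.≤ q z i
    θ≤qz i d = ℚ.≤-trans
      (covers z (z [ i ]≔ lookup x i) (λ e → sensitive (trans (sym e) (minimal i d))))
      (sum-differing-update z i (lookup x i) (0≤q z))

  -- Truncation loses at most the threshold per coordinate. Summed over a minimal block this is ½θ
  -- times (block size times θ), hence at most ½θ by `minimalBlock-small`. The bound passes to all
  -- of `differing x y` because the block lies inside it.
  truncate-covers : Covers f (½ ℚ.* θ) (λ x i → truncate (½ ℚ.* θ ℚ.* θ) (q x i))
  truncate-covers x y fy≢fx = begin
    ½ ℚ.* θ
      ≤⟨ ≤-by _ (0≤a-b θ≤) (rearrange θ (sum (differing x z) (r x))) ⟩
    sum (differing x z) (r x)
      ≤⟨ sum-differing-mono x z x y (0≤r x) (λ i d → between i d , ℚ.≤-refl) ⟩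
    sum (differing x y) (r x) ∎
    where
    open ℚ.≤-Reasoning
    β = minimalBlock f x y fy≢fx
    open MinimalBlock β renaming (flipped to z)
    rearrange : ∀ θ s → s ≡ ½ ℚ.* θ ℚ.+ (s ℚ.+ ½ ℚ.* θ ℚ.- θ)
    rearrange = solve-∀ ring
    θ≤ : θ ℚ.≤ sum (differing x z) (r x) ℚ.+ ½ ℚ.* θ
    θ≤ = begin
      θ
        ≤⟨ covers x z sensitive ⟩
      sum (differing x z) (q x)
        ≤⟨ sum-mono (differing x z) (λ i → ≤truncate+c threshold (0≤q x i) 0≤threshold) ⟩
      sum (differing x z) (λ i → r x i ℚ.+ ½ ℚ.* θ ℚ.* θ)
        ≡⟨ trans (sum-distrib-+ (differing x z) (r x) (λ _ → ½ ℚ.* θ ℚ.* θ))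
             (cong (sum (differing x z) (r x) ℚ.+_)
               (*-distribˡ-sum (½ ℚ.* θ) (differing x z) (λ _ → θ))) ⟩
      sum (differing x z) (r x) ℚ.+ ½ ℚ.* θ ℚ.* sum (differing x z) (λ _ → θ)
        ≤⟨ ℚ.+-monoʳ-≤ (sum (differing x z) (r x))
             (*-monoˡ (0≤a*b 0≤½ 0≤θ) (minimalBlock-small β)) ⟩
      sum (differing x z) (r x) ℚ.+ ½ ℚ.* θ ℚ.* 1ℚ
        ≡⟨ cong (sum (differing x z) (r x) ℚ.+_) (ℚ.*-identityʳ (½ ℚ.* θ)) ⟩
      sum (differing x z) (r x) ℚ.+ ½ ℚ.* θ ∎

-- The input taking each differing bit from whichever of x and y gives it the larger
-- weight differs from either one only where that one has the smaller weight.
covers-⊓ : ∀ {n} (f : BoolFun n) {θ} {w : Vec Bool n → Fin n → ℚ} →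
  (∀ x i → 0ℚ ℚ.≤ w x i) → Covers f θ w → ∀ x y → f y ≢ f x →
  θ ℚ.≤ sum (differing x y) (λ i → w x i ℚ.⊓ w y i)
covers-⊓ {n} f {θ} {w} 0≤w covers x y fy≢fx = by-value (f z Bool.≟ f x)
  where
  choose : ∀ i → Dec (w x i ℚ.≤ w y i) → Bool
  choose i (yes _) = lookup y i
  choose i (no _)  = lookup x i
  z : Vec Bool n
  z = Vec.tabulate λ i → choose i (w x i ℚ.≤? w y i)
  lookup-z : ∀ i → lookup z i ≡ choose i (w x i ℚ.≤? w y i)
  lookup-z = Vec.lookup∘tabulate _
  0≤⊓ : ∀ i → 0ℚ ℚ.≤ w x i ℚ.⊓ w y i
  0≤⊓ i = ℚ.⊓-glb (0≤w x i) (0≤w y i)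
  on-x : ∀ i → lookup x i ≢ lookup z i →
    lookup x i ≢ lookup y i × w x i ℚ.≤ w x i ℚ.⊓ w y i
  on-x i d with w x i ℚ.≤? w y i | lookup-z i
  ... | yes x≤y | z≡y = (λ x≡y → d (trans x≡y (sym z≡y))) , ℚ.⊓-glb ℚ.≤-refl x≤y
  ... | no  _   | z≡x = ⊥-elim (d (sym z≡x))
  on-y : ∀ i → lookup y i ≢ lookup z i →
    lookup x i ≢ lookup y i × w y i ℚ.≤ w x i ℚ.⊓ w y i
  on-y i d with w x i ℚ.≤? w y i | lookup-z i
  ... | yes _   | z≡y = ⊥-elim (d (sym z≡y))
  ... | no  x≰y | z≡x =
    (λ x≡y → d (trans (sym x≡y) (sym z≡x))) , ℚ.⊓-glb (ℚ.<⇒≤ (ℚ.≰⇒> x≰y)) ℚ.≤-refl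
  -- As `f x` and `f y` differ, `f z` differs from one of them, and the covering condition is
  -- applied at that input.
  by-value : Dec (f z ≡ f x) → θ ℚ.≤ sum (differing x y) (λ i → w x i ℚ.⊓ w y i)
  by-value (no fz≢fx) =
    ℚ.≤-trans (covers x z fz≢fx) (sum-differing-mono x z x y 0≤⊓ on-x)
  by-value (yes fz≡fx) =
    ℚ.≤-trans (covers y z (λ fz≡fy → fy≢fx (trans (sym fz≡fy) fz≡fx)))
              (sum-differing-mono y z x y 0≤⊓ on-y)

-- The missing mass goes to coordinate 0, so that a weight of total at most 1 becomes a distribution
-- without decreasing anywhere. This is where at least one coordinate is required.
topUp : ∀ {n} → (Fin (suc n) → ℚ) → Fin (suc n) → ℚ
topUp {n} w zero    = w zero ℚ.+ (1ℚ ℚ.- sum (allFin (suc n)) w)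
topUp     w (suc i) = w (suc i)

sum-topUp : ∀ {n} (w : Fin (suc n) → ℚ) → sum (allFin (suc n)) (topUp w) ≡ 1ℚ
sum-topUp {n} w = begin
  sum (allFin (suc n)) (topUp w)
    ≡⟨ sum-allFin-suc n (topUp w) ⟩
  w zero ℚ.+ (1ℚ ℚ.- sum (allFin (suc n)) w) ℚ.+ s
    ≡⟨ cong (λ t → w zero ℚ.+ (1ℚ ℚ.- t) ℚ.+ s) (sum-allFin-suc n w) ⟩
  w zero ℚ.+ (1ℚ ℚ.- (w zero ℚ.+ s)) ℚ.+ s
    ≡⟨ cancel (w zero) s ⟩
  1ℚ ∎
  where
  open ≡-Reasoning
  s = sum (allFin n) (w ∘ suc)
  cancel : ∀ a s → a ℚ.+ (1ℚ ℚ.- (a ℚ.+ s)) ℚ.+ s ≡ 1ℚ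
  cancel = solve-∀ ring

≤topUp : ∀ {n} (w : Fin (suc n) → ℚ) → sum (allFin (suc n)) w ℚ.≤ 1ℚ → ∀ i → w i ℚ.≤ topUp w i
≤topUp w ∑w≤1 zero    = ≤-by _ (0≤a-b ∑w≤1) refl
≤topUp w ∑w≤1 (suc i) = ℚ.≤-refl

-- The bound θ³/4 is kept as a product of its two sources: the threshold, which turns minima into
-- products, and the covering constant ½θ that survives truncation.
covers⇒private : ∀ {n} (f : BoolFun (suc n)) {θ} → 0ℚ ℚ.≤ θ → ∀ {q} →
  (∀ x i → 0ℚ ℚ.≤ q x i) → (∀ x → sum (allFin (suc n)) (q x) ℚ.≤ 1ℚ) → Covers f θ q →
  Σ[ p ∈ (Vec Bool (suc n) → Fin (suc n) → ℚ) ]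
    (∀ x i → 0ℚ ℚ.≤ p x i) × (∀ x → sum (allFin (suc n)) (p x) ≡ 1ℚ) ×
    (∀ x y → f y ≢ f x →
      ½ ℚ.* θ ℚ.* θ ℚ.* (½ ℚ.* θ) ℚ.≤ sum (differing x y) (λ i → p x i ℚ.* p y i))
covers⇒private {n} f {θ} 0≤θ {q} 0≤q ∑q≤1 covers =
  (λ x → topUp (r x)) , 0≤p , (λ x → sum-topUp (r x)) , win
  where
  open ℚ.≤-Reasoning
  c : ℚ
  c = ½ ℚ.* θ ℚ.* θ
  0≤c : 0ℚ ℚ.≤ c
  0≤c = 0≤a*b (0≤a*b 0≤½ 0≤θ) 0≤θ
  r : Vec Bool (suc n) → Fin (suc n) → ℚ
  r x i = truncate c (q x i)
  0≤r : ∀ x i → 0ℚ ℚ.≤ r x i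
  0≤r x i = truncate-nonNeg c (0≤q x i)
  r≤p : ∀ x i → r x i ℚ.≤ topUp (r x) i
  r≤p x = ≤topUp (r x)
    (ℚ.≤-trans (sum-mono (allFin (suc n)) λ i → truncate≤ c (0≤q x i)) (∑q≤1 x))
  0≤p : ∀ x i → 0ℚ ℚ.≤ topUp (r x) i
  0≤p x i = ℚ.≤-trans (0≤r x i) (r≤p x i)
  win : ∀ x y → f y ≢ f x →
    c ℚ.* (½ ℚ.* θ) ℚ.≤ sum (differing x y) (λ i → topUp (r x) i ℚ.* topUp (r y) i)
  win x y fy≢fx = begin
    c ℚ.* (½ ℚ.* θ)
      ≤⟨ *-monoˡ 0≤c (covers-⊓ f 0≤r (truncate-covers f 0≤θ 0≤q ∑q≤1 covers) x y fy≢fx) ⟩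
    c ℚ.* sum (differing x y) (λ i → r x i ℚ.⊓ r y i)
      ≡⟨ *-distribˡ-sum c (differing x y) _ ⟨
    sum (differing x y) (λ i → c ℚ.* (r x i ℚ.⊓ r y i))
      ≤⟨ sum-mono (differing x y) (λ i → ℚ.≤-trans
           (c*⊓≤*-truncate c 0≤c (0≤q x i) (0≤q y i))
           (ℚ.≤-trans (*-monoʳ (0≤r y i) (r≤p x i)) (*-monoˡ (0≤p x i) (r≤p y i)))) ⟩
    sum (differing x y) (λ i → topUp (r x) i ℚ.* topUp (r y) i) ∎

-- Real numbers

Eventually : (ℕ → Set) → Set
Eventually P = ∃[ N ] (∀ n → N ℕ.≤ n → P n)

eventually-map : ∀ {P Q : ℕ → Set} → (∀ n → P n → Q n) → Eventually P → Eventually Q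
eventually-map f (N , p) = N , λ n N≤n → f n (p n N≤n)

eventually-× : ∀ {P Q : ℕ → Set} → Eventually P → Eventually Q → Eventually (λ n → P n × Q n)
eventually-× (M , p) (N , q) = M ℕ.⊔ N , λ n le →
  p n (ℕ.m⊔n≤o⇒m≤o M N le) , q n (ℕ.m⊔n≤o⇒n≤o M N le)

eventually-∀ : ∀ {k} {P : Fin k → ℕ → Set} → (∀ i → Eventually (P i)) →
  Eventually (λ n → ∀ i → P i n)
eventually-∀ {zero}  ps = 0 , λ _ _ ()
eventually-∀ {suc k} ps =
  eventually-map (λ { n (p , q) zero → p ; n (p , q) (suc i) → q i })
    (eventually-× (ps zero) (eventually-∀ (ps ∘ suc)))

0<½*ε : ∀ {ε} → 0ℚ ℚ.< ε → 0ℚ ℚ.< ½ ℚ.* ε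
0<½*ε 0<ε = ℚ.*-monoʳ-<-pos ½ 0<ε

divide : ∀ {k ε} → 0ℚ ℚ.< k → 0ℚ ℚ.< ε → ∃[ δ ] (0ℚ ℚ.< δ × δ ℚ.* k ≡ ε)
divide {k} {ε} 0<k 0<ε = ε ℚ.* ℚ.1/ k , 0<ε/k , (begin
  ε ℚ.* ℚ.1/ k ℚ.* k    ≡⟨ ℚ.*-assoc ε (ℚ.1/ k) k ⟩
  ε ℚ.* (ℚ.1/ k ℚ.* k)  ≡⟨ cong (ε ℚ.*_) (ℚ.*-inverseˡ k) ⟩
  ε ℚ.* 1ℚ              ≡⟨ ℚ.*-identityʳ ε ⟩
  ε                     ∎)
  where
  open ≡-Reasoning
  instance
    k-pos : ℚ.Positive k
    k-pos = ℚ.positive 0<k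
    k≢0 : ℚ.NonZero k
    k≢0 = ℚ.pos⇒nonZero k
  0<ε/k : 0ℚ ℚ.< ε ℚ.* ℚ.1/ k
  0<ε/k = ℚ.positive⁻¹ _ {{ℚ.pos*pos⇒pos ε {{ℚ.positive 0<ε}} (ℚ.1/ k) {{ℚ.1/pos⇒pos k}}}}

p≤∣p∣ : ∀ p → p ℚ.≤ ∣ p ∣
p≤∣p∣ p with ℚ.≤-total 0ℚ p
... | inj₁ 0≤p = ℚ.≤-reflexive (sym (ℚ.0≤p⇒∣p∣≡p 0≤p))
... | inj₂ p≤0 = ℚ.≤-trans p≤0 (ℚ.0≤∣p∣ p)

-- The one-sided Cauchy bound is anchored at an index `N` that will be frozen, so that its term can
-- be compared with the whole tail.
cauchy-≤ : ∀ x ε → 0ℚ ℚ.< ε → Eventually (λ N → ∀ n → N ℕ.≤ n → seq x N ℚ.≤ seq x n ℚ.+ ε)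
cauchy-≤ x ε 0<ε with M , close ← cauchy x ε 0<ε
  = M , λ N M≤N n N≤n → ≤-by _
      (0≤a-b (ℚ.≤-trans (p≤∣p∣ _) (close N n M≤N (ℕ.≤-trans M≤N N≤n))))
      (rearrange (seq x N) (seq x n) ε)
  where
  rearrange : ∀ a b ε → b ℚ.+ ε ≡ a ℚ.+ (ε ℚ.- (a ℚ.- b))
  rearrange = solve-∀ ring

boundedAbove : ∀ x → ∃[ B ] (0ℚ ℚ.< B × Eventually (λ n → seq x n ℚ.≤ B))
boundedAbove x with N , close ← cauchy x 1ℚ (ℚ.positive⁻¹ 1ℚ)
  = 1ℚ ℚ.+ ∣ seq x N ∣
  , ℚ.+-mono-<-≤ (ℚ.positive⁻¹ 1ℚ) (ℚ.0≤∣p∣ (seq x N))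
  , N , λ n N≤n → ≤-by _
      (0≤a+b (0≤a-b (ℚ.≤-trans (p≤∣p∣ _) (close n N N≤n ℕ.≤-refl)))
             (0≤a-b (p≤∣p∣ (seq x N))))
      (rearrange (seq x n) (seq x N) ∣ seq x N ∣)
  where
  rearrange : ∀ a b c → 1ℚ ℚ.+ c ≡ a ℚ.+ (1ℚ ℚ.- (a ℚ.- b) ℚ.+ (c ℚ.- b))
  rearrange = solve-∀ ring

≤-trans : ∀ {x y z} → x ≤ y → y ≤ z → x ≤ z
≤-trans {x} {y} {z} x≤y y≤z ε 0<ε = eventually-map
  (λ n (p , q) → ≤-by _ (0≤a+b (0≤a-b p) (0≤a-b q)) (rearrange (seq x n) (seq y n) (seq z n) ε))
  (eventually-× (x≤y (½ ℚ.* ε) (0<½*ε 0<ε)) (y≤z (½ ℚ.* ε) (0<½*ε 0<ε)))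
  where
  rearrange : ∀ a b c ε →
    c ℚ.+ ε ≡ a ℚ.+ ((b ℚ.+ ½ ℚ.* ε ℚ.- a) ℚ.+ (c ℚ.+ ½ ℚ.* ε ℚ.- b))
  rearrange = solve-∀ ring

≤-fromSeq : ∀ {x y} → (∀ n → seq x n ℚ.≤ seq y n) → x ≤ y
≤-fromSeq {x} {y} le ε 0<ε = 0 , λ n _ →
  ≤-by _ (0≤a+b (0≤a-b (le n)) (ℚ.<⇒≤ 0<ε)) (rearrange (seq x n) (seq y n) ε)
  where
  rearrange : ∀ a b ε → b ℚ.+ ε ≡ a ℚ.+ (b ℚ.- a ℚ.+ ε)
  rearrange = solve-∀ ring

≃-fromSeq : ∀ {x y} → (∀ n → seq x n ≡ seq y n) → x ≃ y
≃-fromSeq {x} {y} eq = ≤-fromSeq {x} {y} (λ n → ℚ.≤-reflexive (eq n))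
                     , ≤-fromSeq {y} {x} (λ n → ℚ.≤-reflexive (sym (eq n)))

-- The terms of a nonnegative real may be slightly negative. They are therefore shifted to become
-- nonnegative before being multiplied, and upper bounds on both factors control the cross terms.
*-nonNeg : ∀ {x y} → 0ℝ ≤ x → 0ℝ ≤ y → 0ℝ ≤ x * y
*-nonNeg {x} {y} 0≤x 0≤y ε 0<ε =
  let B , 0<B , x≤B = boundedAbove x
      C , 0<C , y≤C = boundedAbove y
      δ , 0<δ , δC≡½ε   = divide 0<C (0<½*ε 0<ε)
      -- `η` is chosen after `δ`, since the total error is δC + η(B + δ); each summand receives half
      -- of `ε`.
      η , 0<η , ηB+δ≡½ε = divide {B ℚ.+ δ} (ℚ.+-mono-< 0<B 0<δ) (0<½*ε 0<ε)
  in eventually-map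
       (λ n ((x≤B , y≤C) , (0≤x+δ , 0≤y+η)) →
         ≤-by _
           (0≤a+b (0≤a+b (0≤a*b 0≤x+δ 0≤y+η) (0≤a*b (ℚ.<⇒≤ 0<η) (0≤a-b x≤B)))
                  (0≤a*b (ℚ.<⇒≤ 0<δ) (0≤a-b y≤C)))
           (rearrange (seq x n) (seq y n) B C δ η ε δC≡½ε ηB+δ≡½ε))
       (eventually-× (eventually-× x≤B y≤C) (eventually-× (0≤x δ 0<δ) (0≤y η 0<η)))
  where
  open ≡-Reasoning
  expand : ∀ x y B C δ η → x ℚ.* y ℚ.+ (δ ℚ.* C ℚ.+ η ℚ.* (B ℚ.+ δ)) ≡
    0ℚ ℚ.+ ((x ℚ.+ δ) ℚ.* (y ℚ.+ η) ℚ.+ η ℚ.* (B ℚ.- x) ℚ.+ δ ℚ.* (C ℚ.- y))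
  expand = solve-∀ ring
  halves : ∀ ε → ε ≡ ½ ℚ.* ε ℚ.+ ½ ℚ.* ε
  halves = solve-∀ ring
  rearrange : ∀ x y B C δ η ε → δ ℚ.* C ≡ ½ ℚ.* ε → η ℚ.* (B ℚ.+ δ) ≡ ½ ℚ.* ε →
    x ℚ.* y ℚ.+ ε ≡
    0ℚ ℚ.+ ((x ℚ.+ δ) ℚ.* (y ℚ.+ η) ℚ.+ η ℚ.* (B ℚ.- x) ℚ.+ δ ℚ.* (C ℚ.- y))
  rearrange x y B C δ η ε e₁ e₂ =
    trans (cong (x ℚ.* y ℚ.+_) (trans (halves ε) (cong₂ ℚ._+_ (sym e₁) (sym e₂))))
          (expand x y B C δ η)

-- The cap at 1 keeps `1ℚ - δ` usable as a nonnegative term in the certificates for `1≤*` and `*≤1`.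
tolerance : ∀ ε → 0ℚ ℚ.< ε → ∃[ δ ] (0ℚ ℚ.< δ × δ ℚ.≤ 1ℚ × δ ℚ.+ (δ ℚ.+ δ) ℚ.≤ ε)
tolerance ε 0<ε with divide {1ℚ ℚ.+ (1ℚ ℚ.+ 1ℚ)} (ℚ.positive⁻¹ _) 0<ε
... | δ , 0<δ , 3δ≡ε with ℚ.≤-total δ 1ℚ
...   | inj₁ δ≤1 = δ , 0<δ , δ≤1 , ℚ.≤-reflexive (trans (triple δ) 3δ≡ε)
  where
  triple : ∀ δ → δ ℚ.+ (δ ℚ.+ δ) ≡ δ ℚ.* (1ℚ ℚ.+ (1ℚ ℚ.+ 1ℚ))
  triple = solve-∀ ring
...   | inj₂ 1≤δ = 1ℚ , ℚ.positive⁻¹ 1ℚ , ℚ.≤-refl ,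
  subst (_ ℚ.≤_) 3δ≡ε (*-monoʳ (ℚ.nonNegative⁻¹ (1ℚ ℚ.+ (1ℚ ℚ.+ 1ℚ))) 1≤δ)

1≤* : ∀ {x y} → 1ℝ ≤ x → 1ℝ ≤ y → 1ℝ ≤ x * y
1≤* {x} {y} 1≤x 1≤y ε 0<ε =
  let δ , 0<δ , δ≤1 , 3δ≤ε = tolerance ε 0<ε
      0≤δ = ℚ.<⇒≤ 0<δ
  in eventually-map
       (λ n (1≤x+δ , 1≤y+δ) → ≤-by _
         (0≤a+b (0≤a+b (0≤a*b (0≤a-b 1≤x+δ) (0≤a+b (0≤a-b 1≤y+δ) (0≤a-b δ≤1)))
                       (0≤a+b (0≤a*b (0≤a-b δ≤1) (0≤a-b 1≤y+δ)) (0≤a*b 0≤δ 0≤δ)))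
                (0≤a+b (0≤a-b 3δ≤ε) 0≤δ))
         (rearrange (seq x n) (seq y n) δ ε))
       (eventually-× (1≤x δ 0<δ) (1≤y δ 0<δ))
  where
  rearrange : ∀ x y δ ε → x ℚ.* y ℚ.+ ε ≡
    1ℚ ℚ.+ ((x ℚ.+ δ ℚ.- 1ℚ) ℚ.* (y ℚ.+ δ ℚ.- 1ℚ ℚ.+ (1ℚ ℚ.- δ))
      ℚ.+ ((1ℚ ℚ.- δ) ℚ.* (y ℚ.+ δ ℚ.- 1ℚ) ℚ.+ δ ℚ.* δ)
      ℚ.+ (ε ℚ.- (δ ℚ.+ (δ ℚ.+ δ)) ℚ.+ δ))
  rearrange = solve-∀ ring

-- Upper bounds alone would not do, as two negative factors can have a large product; the lower
-- bound on `y` excludes this. Hence `product≤1` assumes two-sided bounds.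
*≤1 : ∀ {x y} → x ≤ 1ℝ → 1ℝ ≤ y → y ≤ 1ℝ → x * y ≤ 1ℝ
*≤1 {x} {y} x≤1 1≤y y≤1 ε 0<ε =
  let δ , 0<δ , δ≤1 , 3δ≤ε = tolerance ε 0<ε
      0≤δ = ℚ.<⇒≤ 0<δ
  in eventually-map
       (λ n (x≤1+δ , 1≤y+δ , y≤1+δ) → ≤-by _
         (0≤a+b (0≤a+b (0≤a*b (0≤a-b x≤1+δ) (0≤a+b (0≤a-b 1≤y+δ) (0≤a-b δ≤1)))
                       (0≤a*b (0≤a+b 0≤1 0≤δ) (0≤a-b y≤1+δ)))
                (0≤a+b (0≤a-b 3δ≤ε) (0≤a*b 0≤δ (0≤a-b δ≤1))))
         (rearrange (seq x n) (seq y n) δ ε))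
       (eventually-× (x≤1 δ 0<δ) (eventually-× (1≤y δ 0<δ) (y≤1 δ 0<δ)))
  where
  rearrange : ∀ x y δ ε → 1ℚ ℚ.+ ε ≡
    x ℚ.* y ℚ.+ ((1ℚ ℚ.+ δ ℚ.- x) ℚ.* (y ℚ.+ δ ℚ.- 1ℚ ℚ.+ (1ℚ ℚ.- δ))
      ℚ.+ (1ℚ ℚ.+ δ) ℚ.* (1ℚ ℚ.+ δ ℚ.- y)
      ℚ.+ (ε ℚ.- (δ ℚ.+ (δ ℚ.+ δ)) ℚ.+ δ ℚ.* (1ℚ ℚ.- δ)))
  rearrange = solve-∀ ring

1≤product : ∀ {k} (S : Fin k → ℝ) → (∀ j → 1ℝ ≤ S j) → 1ℝ ≤ Vector.foldr _*_ 1ℝ S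
1≤product {zero}  S 1≤S = ≤-fromSeq {1ℝ} {1ℝ} λ _ → ℚ.≤-refl
1≤product {suc k} S 1≤S =
  1≤* {S zero} {Vector.foldr _*_ 1ℝ (S ∘ suc)} (1≤S zero) (1≤product (S ∘ suc) (1≤S ∘ suc))

product≤1 : ∀ {k} (S : Fin k → ℝ) → (∀ j → S j ≃ 1ℝ) → Vector.foldr _*_ 1ℝ S ≤ 1ℝ
product≤1 {zero}  S S≃1 = ≤-fromSeq {1ℝ} {1ℝ} λ _ → ℚ.≤-refl
product≤1 {suc k} S S≃1 =
  *≤1 {S zero} {Vector.foldr _*_ 1ℝ (S ∘ suc)} (proj₁ (S≃1 zero))
      (1≤product (S ∘ suc) (proj₂ ∘ S≃1 ∘ suc)) (product≤1 (S ∘ suc) (S≃1 ∘ suc))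

-- Independent strategies

mass : ∀ {n k} → (Fin k → Fin n → ℝ) → Vec (Fin n) k → ℝ
mass g []      = 1ℝ
mass g (a ∷ A) = g zero a * mass (g ∘ suc) A

mass-nonNeg : ∀ {n k} (g : Fin k → Fin n → ℝ) → (∀ j i → 0ℝ ≤ g j i) → ∀ A → 0ℝ ≤ mass g A
mass-nonNeg g 0≤g []      = ≤-fromSeq {0ℝ} {1ℝ} λ _ → 0≤1
mass-nonNeg g 0≤g (a ∷ A) =
  *-nonNeg {g zero a} {mass (g ∘ suc) A} (0≤g zero a) (mass-nonNeg (g ∘ suc) (0≤g ∘ suc) A)

sum-products : ∀ {A B : Set} (xs : List A) (ys : List B) g h →
  sum xs (λ a → sum ys (λ b → g a ℚ.* h b)) ≡ sum xs g ℚ.* sum ys h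
sum-products xs ys g h =
  trans (sum-cong xs λ a → *-distribˡ-sum (g a) ys h) (*-distribʳ-sum (sum ys h) xs g)

module _ {n : ℕ} where

  totals : ∀ {k} → (Fin k → Fin n → ℝ) → Fin k → ℝ
  totals g j = ∑ (allFin n) (g j)

  sum-mass : ∀ {k} (g : Fin k → Fin n → ℝ) m →
    sum (allVecs (allFin n) k) (λ A → seq (mass g A) m)
      ≡ seq (Vector.foldr _*_ 1ℝ (totals g)) m
  sum-mass {zero}  g m = ℚ.+-identityʳ 1ℚ
  sum-mass {suc k} g m = begin
    sum (allVecs (allFin n) (suc k)) (λ A → seq (mass g A) m)
      ≡⟨ sum-cartesianProductWith _∷_ (allFin n) (allVecs (allFin n) k) (λ A → seq (mass g A) m) ⟩
    sum (allFin n) (λ a → sum (allVecs (allFin n) k)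
      (λ A → seq (g zero a) m ℚ.* seq (mass (g ∘ suc) A) m))
      ≡⟨ sum-products (allFin n) (allVecs (allFin n) k) (λ a → seq (g zero a) m)
           (λ A → seq (mass (g ∘ suc) A) m) ⟩
    sum (allFin n) (λ a → seq (g zero a) m)
      ℚ.* sum (allVecs (allFin n) k) (λ A → seq (mass (g ∘ suc) A) m)
      ≡⟨ cong₂ ℚ._*_ (sym (seq-∑ (allFin n) (g zero) m)) (sum-mass (g ∘ suc) m) ⟩
    seq (totals g zero) m ℚ.* seq (Vector.foldr _*_ 1ℝ (totals (g ∘ suc))) m ∎
    where open ≡-Reasoning

  -- The totals of real distributions equal 1 only in the limit. At a fixed index, taking the
  -- marginal of a product measure at coordinate `j` leaves the product of all the other totals as a
  -- factor.
  totalsExcept : ∀ {k} → Fin k → (Fin k → Fin n → ℝ) → ℝ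
  totalsExcept zero    g = Vector.foldr _*_ 1ℝ (totals (g ∘ suc))
  totalsExcept (suc j) g = totals g zero * totalsExcept j (g ∘ suc)

  1≤totalsExcept : ∀ {k} (j : Fin k) g → (∀ j → 1ℝ ≤ totals g j) → 1ℝ ≤ totalsExcept j g
  1≤totalsExcept zero    g 1≤S = 1≤product (totals (g ∘ suc)) (1≤S ∘ suc)
  1≤totalsExcept (suc j) g 1≤S =
    1≤* {totals g zero} {totalsExcept j (g ∘ suc)} (1≤S zero) (1≤totalsExcept j (g ∘ suc) (1≤S ∘ suc))

  sum-mass-lookup : ∀ {k} (g : Fin k → Fin n → ℝ) m j (h : Fin n → ℚ) →
    sum (allVecs (allFin n) k) (λ A → h (lookup A j) ℚ.* seq (mass g A) m)
      ≡ sum (allFin n) (λ i → h i ℚ.* seq (g j i) m) ℚ.* seq (totalsExcept j g) m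
  sum-mass-lookup {suc k} g m zero h = begin
    sum (allVecs (allFin n) (suc k)) (λ A → h (lookup A zero) ℚ.* seq (mass g A) m)
      ≡⟨ sum-cartesianProductWith _∷_ (allFin n) (allVecs (allFin n) k) _ ⟩
    sum (allFin n) (λ a → sum (allVecs (allFin n) k)
      (λ A → h a ℚ.* (seq (g zero a) m ℚ.* seq (mass (g ∘ suc) A) m)))
      ≡⟨ sum-cong (allFin n) (λ a → sum-cong (allVecs (allFin n) k)
           λ A → sym (ℚ.*-assoc (h a) (seq (g zero a) m) (seq (mass (g ∘ suc) A) m))) ⟩
    sum (allFin n) (λ a → sum (allVecs (allFin n) k)
      (λ A → h a ℚ.* seq (g zero a) m ℚ.* seq (mass (g ∘ suc) A) m))
      ≡⟨ sum-products (allFin n) (allVecs (allFin n) k) (λ a → h a ℚ.* seq (g zero a) m)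
           (λ A → seq (mass (g ∘ suc) A) m) ⟩
    sum (allFin n) (λ a → h a ℚ.* seq (g zero a) m)
      ℚ.* sum (allVecs (allFin n) k) (λ A → seq (mass (g ∘ suc) A) m)
      ≡⟨ cong (sum (allFin n) (λ a → h a ℚ.* seq (g zero a) m) ℚ.*_) (sum-mass (g ∘ suc) m) ⟩
    sum (allFin n) (λ a → h a ℚ.* seq (g zero a) m) ℚ.* seq (totalsExcept zero g) m ∎
    where open ≡-Reasoning
  sum-mass-lookup {suc k} g m (suc j) h = begin
    sum (allVecs (allFin n) (suc k)) (λ A → h (lookup A (suc j)) ℚ.* seq (mass g A) m)
      ≡⟨ sum-cartesianProductWith _∷_ (allFin n) (allVecs (allFin n) k) _ ⟩
    sum (allFin n) (λ a → sum (allVecs (allFin n) k)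
      (λ A → h (lookup A j) ℚ.* (seq (g zero a) m ℚ.* seq (mass (g ∘ suc) A) m)))
      ≡⟨ sum-cong (allFin n) (λ a → sum-cong (allVecs (allFin n) k)
           λ A → swap (h (lookup A j)) (seq (g zero a) m) (seq (mass (g ∘ suc) A) m)) ⟩
    sum (allFin n) (λ a → sum (allVecs (allFin n) k)
      (λ A → seq (g zero a) m ℚ.* (h (lookup A j) ℚ.* seq (mass (g ∘ suc) A) m)))
      ≡⟨ sum-products (allFin n) (allVecs (allFin n) k) (λ a → seq (g zero a) m)
           (λ A → h (lookup A j) ℚ.* seq (mass (g ∘ suc) A) m) ⟩
    sum (allFin n) (λ a → seq (g zero a) m)
      ℚ.* sum (allVecs (allFin n) k) (λ A → h (lookup A j) ℚ.* seq (mass (g ∘ suc) A) m)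
      ≡⟨ cong₂ ℚ._*_ (sym (seq-∑ (allFin n) (g zero) m)) (sum-mass-lookup (g ∘ suc) m j h) ⟩
    seq (totals g zero) m
      ℚ.* (sum (allFin n) (λ i → h i ℚ.* seq (g (suc j) i) m) ℚ.* seq (totalsExcept j (g ∘ suc)) m)
      ≡⟨ swap (seq (totals g zero) m) (sum (allFin n) (λ i → h i ℚ.* seq (g (suc j) i) m))
           (seq (totalsExcept j (g ∘ suc)) m) ⟩
    sum (allFin n) (λ i → h i ℚ.* seq (g (suc j) i) m) ℚ.* seq (totalsExcept (suc j) g) m ∎
    where
    open ≡-Reasoning
    swap : ∀ a b c → a ℚ.* (b ℚ.* c) ≡ b ℚ.* (a ℚ.* c)
    swap = solve-∀ ring

-- Public coins simulate private coins

module _ {n} (f : BoolFun n) (p : PrivateStrategy n) where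
  open PrivateStrategy p

  private
    g : ∀ b → Preimage f b → Fin n → ℝ
    g b x = prob (input f b x)

    total≃1 : ∀ b x → totals (g b) x ≃ 1ℝ
    total≃1 b x = IsDistribution.total (isDistribution (input f b x))

    1≤except : ∀ b x → 1ℝ ≤ totalsExcept x (g b)
    1≤except b x = 1≤totalsExcept x (g b) (proj₂ ∘ total≃1 b)

    jointMass : StrategyPair f → ℝ
    jointMass (A , B) = mass (g false) A * mass (g true) B

    As : List (Strategy f false)
    As = allVecs (allFin n) _

    Bs : List (Strategy f true)
    Bs = allVecs (allFin n) _

  product-total : ∑ (strategyPairs f) jointMass ≃ 1ℝ
  product-total =
      ≤-trans {∑ (strategyPairs f) jointMass} {P * Q} {1ℝ} (proj₁ total≃PQ)
        (*≤1 {P} {Q} (product≤1 _ (total≃1 false))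
             (1≤product _ (proj₂ ∘ total≃1 true)) (product≤1 _ (total≃1 true)))
    , ≤-trans {1ℝ} {P * Q} {∑ (strategyPairs f) jointMass}
        (1≤* {P} {Q} (1≤product _ (proj₂ ∘ total≃1 false)) (1≤product _ (proj₂ ∘ total≃1 true)))
        (proj₂ total≃PQ)
    where
    open ≡-Reasoning
    P = Vector.foldr _*_ 1ℝ (totals (g false))
    Q = Vector.foldr _*_ 1ℝ (totals (g true))
    total≃PQ : ∑ (strategyPairs f) jointMass ≃ P * Q
    total≃PQ = ≃-fromSeq {∑ (strategyPairs f) jointMass} {P * Q} λ m → begin
      seq (∑ (strategyPairs f) jointMass) m
        ≡⟨ seq-∑ (strategyPairs f) jointMass m ⟩
      sum (strategyPairs f) (λ AB → seq (jointMass AB) m)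
        ≡⟨ sum-cartesianProductWith _,_ As Bs _ ⟩
      sum As (λ A → sum Bs (λ B → seq (mass (g false) A) m ℚ.* seq (mass (g true) B) m))
        ≡⟨ sum-products As Bs (λ A → seq (mass (g false) A) m) (λ B → seq (mass (g true) B) m) ⟩
      sum As (λ A → seq (mass (g false) A) m) ℚ.* sum Bs (λ B → seq (mass (g true) B) m)
        ≡⟨ cong₂ ℚ._*_ (sum-mass (g false) m) (sum-mass (g true) m) ⟩
      seq (P * Q) m ∎

  independent : PublicStrategy f
  independent = record
    { prob           = jointMass
    ; isDistribution = record
      { nonNegative = λ (A , B) → *-nonNeg {mass (g false) A} {mass (g true) B}
          (mass-nonNeg (g false) (0≤g false) A) (mass-nonNeg (g true) (0≤g true) B)
      ; total       = product-total
      }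
    }
    where
    0≤g : ∀ b x i → 0ℝ ≤ g b x i
    0≤g b x = IsDistribution.nonNegative (isDistribution (input f b x))

  -- The identity is exact at every index: independence makes the answers on `x` and `y` a product,
  -- up to the leftover totals of all other inputs.
  seq-publicWin-independent : ∀ x y m → seq (publicWin f independent x y) m ≡
    seq (privateWin p (input f false x) (input f true y)) m
      ℚ.* seq (totalsExcept x (g false) * totalsExcept y (g true)) m
  seq-publicWin-independent x y m = begin
    seq (publicWin f independent x y) m
      ≡⟨ seq-∑ (filter (correct? f x y) (strategyPairs f)) jointMass m ⟩
    sum (filter (correct? f x y) (strategyPairs f)) (λ AB → seq (jointMass AB) m)
      ≡⟨ sum-filter (correct? f x y) (strategyPairs f) _ ⟩
    sum (strategyPairs f) (λ AB → 𝟙 (correct? f x y AB) ℚ.* seq (jointMass AB) m)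
      ≡⟨ sum-cartesianProductWith _,_ As Bs _ ⟩
    sum As (λ A → sum Bs (λ B → 𝟙 (correct? f x y (A , B)) ℚ.* (massA A ℚ.* massB B)))
      -- For fixed `A` only the entry of `B` at `y` matters. Summing over `B` first forces that
      -- entry to equal the answer of `A` on `x`, which `sum-agree` evaluates.
      ≡⟨ sum-cong As (λ A → trans
           (sum-cong Bs λ B → swap (𝟙 (correct? f x y (A , B))) (massA A) (massB B))
           (trans (*-distribˡ-sum (massA A) Bs _)
             (cong (massA A ℚ.*_) (trans
               (sum-mass-lookup (g true) m y (λ j → 𝟙 (agree? (lookup A x) j)))
               (cong (ℚ._* R′) (sum-agree (lookup A x))))))) ⟩
    sum As (λ A → massA A ℚ.* (win (lookup A x) ℚ.* R′))
      ≡⟨ sum-cong As (λ A → rotate (massA A) (win (lookup A x)) R′) ⟩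
    sum As (λ A → win (lookup A x) ℚ.* massA A ℚ.* R′)
      ≡⟨ *-distribʳ-sum R′ As _ ⟩
    sum As (λ A → win (lookup A x) ℚ.* massA A) ℚ.* R′
      ≡⟨ cong (ℚ._* R′) (sum-mass-lookup (g false) m x win) ⟩
    sum (allFin n) (λ i → win i ℚ.* seq (g false x i) m) ℚ.* R ℚ.* R′
      ≡⟨ ℚ.*-assoc (sum (allFin n) (λ i → win i ℚ.* seq (g false x i) m)) R R′ ⟩
    sum (allFin n) (λ i → win i ℚ.* seq (g false x i) m) ℚ.* (R ℚ.* R′)
      ≡⟨ cong (ℚ._* (R ℚ.* R′)) (sum-cong (allFin n) λ i →
           reorder (𝟙 (differ? i)) (seq (g true y i) m) (seq (g false x i) m)) ⟩
    sum (allFin n) (λ i → 𝟙 (differ? i) ℚ.* (seq (g false x i) m ℚ.* seq (g true y i) m))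
      ℚ.* (R ℚ.* R′)
      ≡⟨ cong (ℚ._* (R ℚ.* R′)) (sum-filter differ? (allFin n) _) ⟨
    sum (differing u v) (λ i → seq (g false x i * g true y i) m) ℚ.* (R ℚ.* R′)
      ≡⟨ cong (ℚ._* (R ℚ.* R′)) (seq-∑ (differing u v) (λ i → g false x i * g true y i) m) ⟨
    seq (privateWin p u v) m ℚ.* (R ℚ.* R′) ∎
    where
    open ≡-Reasoning
    u = input f false x
    v = input f true y
    R = seq (totalsExcept x (g false)) m
    R′ = seq (totalsExcept y (g true)) m
    massA : Strategy f false → ℚ
    massA A = seq (mass (g false) A) m
    massB : Strategy f true → ℚ
    massB B = seq (mass (g true) B) m
    differ? : ∀ i → Dec (lookup u i ≢ lookup v i)
    differ? i = ¬? (lookup u i Bool.≟ lookup v i)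
    agree? : ∀ i j → Dec (i ≡ j × lookup u i ≢ lookup v i)
    agree? i j = (i Fin.≟ j) ×-dec differ? i
    win : Fin n → ℚ
    win i = 𝟙 (differ? i) ℚ.* seq (g true y i) m
    𝟙-agree : ∀ {P Q : Set} (P? : Dec P) (Q? : Dec Q) c →
      𝟙 (P? ×-dec Q?) ℚ.* c ≡ 𝟙 P? ℚ.* (𝟙 Q? ℚ.* c)
    𝟙-agree (yes _) (yes _) c = sym (ℚ.*-identityˡ (1ℚ ℚ.* c))
    𝟙-agree (yes _) (no _)  c = sym (ℚ.*-identityˡ (0ℚ ℚ.* c))
    𝟙-agree (no _)  Q?      c = trans (ℚ.*-zeroˡ c) (sym (ℚ.*-zeroˡ (𝟙 Q? ℚ.* c)))
    sum-agree : ∀ i → sum (allFin n) (λ j → 𝟙 (agree? i j) ℚ.* seq (g true y j) m) ≡ win i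
    sum-agree i = trans
      (sum-cong (allFin n) λ j → 𝟙-agree (i Fin.≟ j) (differ? i) (seq (g true y j) m))
      (sum-δ i (λ j → 𝟙 (differ? i) ℚ.* seq (g true y j) m))
    swap : ∀ a b c → a ℚ.* (b ℚ.* c) ≡ b ℚ.* (a ℚ.* c)
    swap = solve-∀ ring
    rotate : ∀ a b c → a ℚ.* (b ℚ.* c) ≡ b ℚ.* a ℚ.* c
    rotate = solve-∀ ring
    reorder : ∀ a b c → a ℚ.* b ℚ.* c ≡ a ℚ.* (c ℚ.* b)
    reorder = solve-∀ ring

  -- The leftover factor is at least 1 as a real, so multiplying by it preserves the lower bound.
  1≤t*publicWin : ∀ t x y → 1ℝ ≤ t * privateWin p (input f false x) (input f true y) →
    1ℝ ≤ t * publicWin f independent x y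
  1≤t*publicWin t x y 1≤tw =
    ≤-trans {1ℝ} {t * w * R} {t * publicWin f independent x y}
      (1≤* {t * w} {R} 1≤tw
        (1≤* {totalsExcept x (g false)} {totalsExcept y (g true)} (1≤except false x) (1≤except true y)))
      (≤-fromSeq {t * w * R} {t * publicWin f independent x y} λ m → ℚ.≤-reflexive
        (trans (ℚ.*-assoc (seq t m) (seq w m) (seq R m))
               (cong (seq t m ℚ.*_) (sym (seq-publicWin-independent x y m)))))
    where
    w = privateWin p (input f false x) (input f true y)
    R = totalsExcept x (g false) * totalsExcept y (g true)

CGpub≤CGpriv : ∀ {n} (f : BoolFun n) → CGpub f ≤∞ CGpriv f
CGpub≤CGpriv f t (p , 0≤t , wins) =
  independent f p , 0≤t , λ (x , y) →
    0≤t , 1≤t*publicWin f p t x y (proj₂ (wins (x , y)))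

-- Marginals of a public strategy

∈-allVecs : ∀ {k} (x : Vec Bool k) → x ∈ allVecs (false ∷ true ∷ []) k
∈-allVecs []      = here refl
∈-allVecs (b ∷ x) = ∈-cartesianProductWith⁺ _∷_ {xs = false ∷ true ∷ []} (∈-bits b) (∈-allVecs x)
  where
  ∈-bits : ∀ b → b ∈ false ∷ true ∷ []
  ∈-bits false = here refl
  ∈-bits true  = there (here refl)

-- Strategies are tables indexed by positions in a preimage; this locates the entry belonging to a
-- given input.
position : ∀ {n} (f : BoolFun n) x → Σ[ k ∈ Preimage f (f x) ] input f (f x) k ≡ x
position f x = index x∈ , sym (lookup-index x∈)
  where
  x∈ : x ∈ preimage f (f x)
  x∈ = ∈-filter⁺ (λ y → f y Bool.≟ f x) (∈-allVecs x) refl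

module _ {A : Set} (as : List A) (w : A → ℚ) {n} (φ : A → Fin n) where

  marginal : Fin n → ℚ
  marginal i = sum as (λ a → 𝟙 (φ a Fin.≟ i) ℚ.* w a)

  marginal-nonNeg : (∀ a → 0ℚ ℚ.≤ w a) → ∀ i → 0ℚ ℚ.≤ marginal i
  marginal-nonNeg 0≤w i = sum-nonNeg as λ a → 0≤a*b (0≤𝟙 (φ a Fin.≟ i)) (0≤w a)

  -- Change of variables for the image of the measure `w` under `φ`.
  sum-*-marginal : ∀ (h : Fin n → ℚ) →
    sum (allFin n) (λ i → h i ℚ.* marginal i) ≡ sum as (λ a → h (φ a) ℚ.* w a)
  sum-*-marginal h = begin
    sum (allFin n) (λ i → h i ℚ.* marginal i)
      ≡⟨ sum-cong (allFin n) (λ i → sym (*-distribˡ-sum (h i) as λ a → 𝟙 (φ a Fin.≟ i) ℚ.* w a)) ⟩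
    sum (allFin n) (λ i → sum as (λ a → h i ℚ.* (𝟙 (φ a Fin.≟ i) ℚ.* w a)))
      ≡⟨ sum-swap (allFin n) as (λ i a → h i ℚ.* (𝟙 (φ a Fin.≟ i) ℚ.* w a)) ⟩
    sum as (λ a → sum (allFin n) (λ i → h i ℚ.* (𝟙 (φ a Fin.≟ i) ℚ.* w a)))
      ≡⟨ sum-cong as (λ a → trans
           (sum-cong (allFin n) λ i → swap (h i) (𝟙 (φ a Fin.≟ i)) (w a))
           (sum-δ (φ a) (λ i → h i ℚ.* w a))) ⟩
    sum as (λ a → h (φ a) ℚ.* w a) ∎
    where
    open ≡-Reasoning
    swap : ∀ a b c → a ℚ.* (b ℚ.* c) ≡ b ℚ.* (a ℚ.* c)
    swap = solve-∀ ring

  sum-marginal : sum (allFin n) marginal ≡ sum as w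
  sum-marginal = begin
    sum (allFin n) marginal
      ≡⟨ sum-cong (allFin n) (λ i → ℚ.*-identityˡ (marginal i)) ⟨
    sum (allFin n) (λ i → 1ℚ ℚ.* marginal i)
      ≡⟨ sum-*-marginal (λ _ → 1ℚ) ⟩
    sum as (λ a → 1ℚ ℚ.* w a)
      ≡⟨ sum-cong as (λ a → ℚ.*-identityˡ (w a)) ⟩
    sum as w ∎
    where open ≡-Reasoning

  -- The event `Q` is contained in the event that the answer `φ a` falls on a differing coordinate.
  -- Keeping `Q` abstract lets the same bound serve both players.
  filter≤differing : (∀ a → 0ℚ ℚ.≤ w a) → ∀ {Q : A → Set} (Q? : Decidable Q) (x y : Vec Bool n) →
    (∀ a → Q a → lookup x (φ a) ≢ lookup y (φ a)) →
    sum (filter Q? as) w ℚ.≤ sum (differing x y) marginal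
  filter≤differing 0≤w Q? x y Q⇒differ = begin
    sum (filter Q? as) w
      ≡⟨ sum-filter Q? as w ⟩
    sum as (λ a → 𝟙 (Q? a) ℚ.* w a)
      ≤⟨ sum-mono as (λ a → 𝟙*-mono (Q? a) (differ? (φ a)) (Q⇒differ a) (λ _ → 0≤w a) (λ _ → ℚ.≤-refl)) ⟩
    sum as (λ a → 𝟙 (differ? (φ a)) ℚ.* w a)
      ≡⟨ sum-*-marginal (λ i → 𝟙 (differ? i)) ⟨
    sum (allFin n) (λ i → 𝟙 (differ? i) ℚ.* marginal i)
      ≡⟨ sum-filter differ? (allFin n) marginal ⟨
    sum (differing x y) marginal ∎
    where
    open ℚ.≤-Reasoning
    differ? : ∀ i → Dec (lookup x i ≢ lookup y i)
    differ? i = ¬? (lookup x i Bool.≟ lookup y i)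

output : ∀ {n} (f : BoolFun n) b → Preimage f b → StrategyPair f → Fin n
output f false x (A , B) = lookup A x
output f true  y (A , B) = lookup B y

module _ {n} (f : BoolFun n) (w : StrategyPair f → ℚ) where

  coverWeight : Vec Bool n → Fin n → ℚ
  coverWeight x = marginal (strategyPairs f) w (output f (f x) (proj₁ (position f x)))

  coverWeight-covers : (∀ AB → 0ℚ ℚ.≤ w AB) → ∀ {θ} →
    (∀ x y → θ ℚ.≤ sum (filter (correct? f x y) (strategyPairs f)) w) →
    Covers f θ coverWeight
  coverWeight-covers 0≤w {θ} θ≤win x y fy≢fx =
    subst₂ (λ u v → θ ℚ.≤ sum (differing u v) (coverWeight x))
      (proj₂ (position f x)) (proj₂ (position f y))
      (covers _ _ (proj₁ (position f x)) (proj₁ (position f y)) fy≢fx)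
    where
    -- Generalised over the bits `b` and `c`, so that matching on them decides which player holds
    -- which input.
    covers : ∀ b c k l → c ≢ b → θ ℚ.≤ sum (differing (input f b k) (input f c l))
      (marginal (strategyPairs f) w (output f b k))
    covers false false k l c≢b = ⊥-elim (c≢b refl)
    covers true  true  k l c≢b = ⊥-elim (c≢b refl)
    covers false true  k l c≢b = ℚ.≤-trans (θ≤win k l)
      (filter≤differing (strategyPairs f) w (output f false k) 0≤w (correct? f k l)
        (input f false k) (input f true l)
        (λ _ → proj₂))
    covers true  false k l c≢b = ℚ.≤-trans (θ≤win l k)
      (filter≤differing (strategyPairs f) w (output f true k) 0≤w (correct? f l k)
        (input f true k) (input f false l)
        (λ (A , B) (A≡B , differ) k≡l → differ
          (subst (λ i → lookup (input f false l) i ≡ lookup (input f true k) i) (sym A≡B) (sym k≡l))))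

-- Rational approximation

-- Each term is eventually above any negative slack, so clipping it at 0 costs at most that slack.
-- The head takes half of `ε` and the tail the other half.
sum-clip : ∀ {A : Set} (as : List A) (p : A → ℝ) → (∀ a → 0ℝ ≤ p a) → ∀ ε → 0ℚ ℚ.< ε →
  Eventually (λ n → sum as (λ a → 0ℚ ℚ.⊔ seq (p a) n) ℚ.≤ sum as (λ a → seq (p a) n) ℚ.+ ε)
sum-clip []       p 0≤p ε 0<ε = 0 , λ _ _ → ≤-by ε (ℚ.<⇒≤ 0<ε) refl
sum-clip (a ∷ as) p 0≤p ε 0<ε = eventually-map
  (λ n (q , r) → ≤-by _ (0≤a+b (0≤a-b (clip n q)) (0≤a-b r))
    (rearrange (seq (p a) n) (0ℚ ℚ.⊔ seq (p a) n) (sum as λ b → seq (p b) n)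
      (sum as λ b → 0ℚ ℚ.⊔ seq (p b) n) ε))
  (eventually-× (0≤p a (½ ℚ.* ε) (0<½*ε 0<ε)) (sum-clip as p 0≤p (½ ℚ.* ε) (0<½*ε 0<ε)))
  where
  clip : ∀ n → 0ℚ ℚ.≤ seq (p a) n ℚ.+ ½ ℚ.* ε → 0ℚ ℚ.⊔ seq (p a) n ℚ.≤ seq (p a) n ℚ.+ ½ ℚ.* ε
  clip n q = ℚ.⊔-lub {seq (p a) n ℚ.+ ½ ℚ.* ε} {0ℚ} {seq (p a) n} q (≤-by _ (ℚ.<⇒≤ (0<½*ε 0<ε)) refl)
  rearrange : ∀ s s⁺ t t⁺ ε → s ℚ.+ t ℚ.+ ε ≡
    s⁺ ℚ.+ t⁺ ℚ.+ ((s ℚ.+ ½ ℚ.* ε ℚ.- s⁺) ℚ.+ (t ℚ.+ ½ ℚ.* ε ℚ.- t⁺))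
  rearrange = solve-∀ ring

∑-nonNeg : ∀ {A : Set} (as : List A) (p : A → ℝ) → (∀ a → 0ℝ ≤ p a) → 0ℝ ≤ ∑ as p
∑-nonNeg as p 0≤p ε 0<ε = eventually-map
  (λ n le → ℚ.≤-trans (sum-nonNeg as λ a → ℚ.p≤p⊔q 0ℚ (seq (p a) n))
    (ℚ.≤-trans le (ℚ.≤-reflexive (cong (ℚ._+ ε) (sym (seq-∑ as p n))))))
  (sum-clip as p 0≤p ε 0<ε)

rational : ∀ {n} (p : Vec Bool n → Fin n → ℚ) → (∀ x i → 0ℚ ℚ.≤ p x i) →
  (∀ x → sum (allFin n) (p x) ≡ 1ℚ) → PrivateStrategy n
rational {n} p 0≤p ∑p≡1 = record
  { prob           = λ x i → fromℚ (p x i)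
  ; isDistribution = λ x → record
    { nonNegative = λ i → ≤-fromSeq {0ℝ} {fromℚ (p x i)} λ _ → 0≤p x i
    ; total       = ≃-fromSeq {∑ (allFin n) (fromℚ ∘ p x)} {1ℝ} λ m →
        trans (seq-∑ (allFin n) (fromℚ ∘ p x) m) (∑p≡1 x)
    }
  }

f-input : ∀ {n} (f : BoolFun n) b (x : Preimage f b) → f (input f b x) ≡ b
f-input f b x =
  proj₂ (∈-filter⁻ (λ y → f y Bool.≟ b) {xs = allVecs (false ∷ true ∷ []) _} (∈-lookup x))

input-separated : ∀ {n} (f : BoolFun n) (x : Preimage f false) (y : Preimage f true) →
  f (input f true y) ≢ f (input f false x)
input-separated f x y fy≡fx =
  true≢false (trans (sym (f-input f true y)) (trans fy≡fx (f-input f false x)))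
  where
  true≢false : true ≢ false
  true≢false ()

-- Private coins from public coins

1/32 1/8 7/8 4ℚ 8ℚ 10ℚ 16ℚ 16³ : ℚ
1/32   = + 1 ℚ./ 32
1/8    = + 1 ℚ./ 8
7/8    = + 7 ℚ./ 8
4ℚ     = + 4 ℚ./ 1
8ℚ     = + 8 ℚ./ 1
10ℚ    = + 10 ℚ./ 1
16ℚ    = + 16 ℚ./ 1
16³    = 16ℚ ℚ.* 16ℚ ℚ.* 16ℚ

cube-mono : ∀ {a b} → 0ℚ ℚ.≤ a → a ℚ.≤ b → a ℚ.* a ℚ.* a ℚ.≤ b ℚ.* b ℚ.* b
cube-mono {a} {b} 0≤a a≤b = begin
  a ℚ.* a ℚ.* a  ≤⟨ *-monoˡ (0≤a*b 0≤a 0≤a) a≤b ⟩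
  a ℚ.* a ℚ.* b  ≤⟨ *-monoʳ 0≤b (ℚ.≤-trans (*-monoˡ 0≤a a≤b) (*-monoʳ 0≤b a≤b)) ⟩
  b ℚ.* b ℚ.* b  ∎
  where
  open ℚ.≤-Reasoning
  0≤b = ℚ.≤-trans 0≤a a≤b

module _ {n} (f : BoolFun n) (P : PublicStrategy f) (T : ℝ) where
  open PublicStrategy P
  open IsDistribution isDistribution

  pairs : List (StrategyPair f)
  pairs = strategyPairs f

  -- The approximations at a finite index of nonnegative reals may be negative.
  clipped : ℕ → StrategyPair f → ℚ
  clipped N AB = 0ℚ ℚ.⊔ seq (prob AB) N

  winAt : ℕ → Preimage f false → Preimage f true → ℚ
  winAt N x y = sum (filter (correct? f x y) pairs) (λ AB → seq (prob AB) N)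

  record Accurate (N : ℕ) : Set where
    field
      total≤2  : sum pairs (clipped N) ℚ.≤ 1ℚ ℚ.+ ½ ℚ.+ ½
      T-nonNeg : 0ℚ ℚ.≤ seq T N ℚ.+ 1/32
      T-close  : ∀ n → N ℕ.≤ n → seq T N ℚ.≤ seq T n ℚ.+ 1/32
      wins     : ∀ x y → 1ℚ ℚ.≤ seq T N ℚ.* winAt N x y ℚ.+ ½
      -1≤win   : ∀ x y → 0ℚ ℚ.≤ winAt N x y ℚ.+ 1ℚ

  eventually-accurate : 0ℝ ≤ T → (∀ x y → 1ℝ ≤ T * publicWin f P x y) → Eventually Accurate
  eventually-accurate 0≤T 1≤Tw = eventually-map
    (λ N ((clip , tot) , (0≤T , close) , (wins , -1≤win)) → record
      { total≤2  = ℚ.≤-trans clip (ℚ.+-monoˡ-≤ ½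
          (ℚ.≤-trans (ℚ.≤-reflexive (sym (seq-∑ pairs prob N))) tot))
      ; T-nonNeg = 0≤T
      ; T-close  = close
      ; wins     = λ x y → ℚ.≤-trans (wins x y)
          (ℚ.≤-reflexive (cong (λ w → seq T N ℚ.* w ℚ.+ ½) (seq-win x y N)))
      ; -1≤win   = λ x y → ℚ.≤-trans (-1≤win x y)
          (ℚ.≤-reflexive (cong (ℚ._+ 1ℚ) (seq-win x y N)))
      })
    (eventually-×
      (eventually-× (sum-clip pairs prob nonNegative ½ (ℚ.positive⁻¹ ½))
                    (proj₁ total ½ (ℚ.positive⁻¹ ½)))
      (eventually-×
        (eventually-× (0≤T 1/32 (ℚ.positive⁻¹ 1/32)) (cauchy-≤ T 1/32 (ℚ.positive⁻¹ 1/32)))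
        (eventually-×
          (eventually-∀ λ x → eventually-∀ λ y → 1≤Tw x y ½ (ℚ.positive⁻¹ ½))
          (eventually-∀ λ x → eventually-∀ λ y →
            ∑-nonNeg (filter (correct? f x y) pairs) prob nonNegative 1ℚ (ℚ.positive⁻¹ 1ℚ)))))
    where
    seq-win : ∀ x y N → seq (publicWin f P x y) N ≡ winAt N x y
    seq-win x y N = seq-∑ (filter (correct? f x y) pairs) prob N

  module _ {N : ℕ} (acc : Accurate N) where
    open Accurate acc

    -- If f is not constant then 1 ≤ M₀ = M; otherwise the maximum keeps M positive.
    M₀ M : ℚ
    M₀ = 8ℚ ℚ.* (seq T N ℚ.+ 1/32)
    M = M₀ ℚ.⊔ 1ℚ

    -- Halving brings the clipped total, which is at most 2, down to at most 1.
    weight : StrategyPair f → ℚ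
    weight AB = ½ ℚ.* clipped N AB

    weight-nonNeg : ∀ AB → 0ℚ ℚ.≤ weight AB
    weight-nonNeg AB = 0≤a*b 0≤½ (ℚ.p≤p⊔q 0ℚ (seq (prob AB) N))

    ∑weight≤1 : sum pairs weight ℚ.≤ 1ℚ
    ∑weight≤1 = ℚ.≤-trans (ℚ.≤-reflexive (*-distribˡ-sum ½ pairs (clipped N)))
      (*-monoˡ 0≤½ total≤2)

    0≤M₀ : 0ℚ ℚ.≤ M₀
    0≤M₀ = 0≤a*b (ℚ.nonNegative⁻¹ 8ℚ) T-nonNeg

    hit : Preimage f false → Preimage f true → ℚ
    hit x y = sum (filter (correct? f x y) pairs) weight

    -- With t and v the approximate `T` and winning probability, M₀ times ½v is 4tv + v/8. Accuracy
    -- gives tv ≥ ½ and v ≥ -1, hence at least 2 - 1/8. The shift by 1/32 makes `M₀` nonnegative, so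
    -- that v may then be replaced by its clipped version.
    1≤M₀*hit : ∀ x y → 1ℚ ℚ.≤ M₀ ℚ.* hit x y
    1≤M₀*hit x y = ℚ.≤-trans
      (≤-by _ (0≤a+b (0≤a+b (0≤a*b (ℚ.nonNegative⁻¹ 4ℚ) (0≤a-b (wins x y)))
                            (0≤a*b (ℚ.nonNegative⁻¹ 1/8) (-1≤win x y)))
                     (ℚ.nonNegative⁻¹ 7/8))
        (rearrange (seq T N) (winAt N x y)))
      (*-monoˡ 0≤M₀ (ℚ.≤-trans (*-monoˡ 0≤½ win≤clipped)
        (ℚ.≤-reflexive (sym (*-distribˡ-sum ½ (filter (correct? f x y) pairs) (clipped N))))))
      where
      win≤clipped : winAt N x y ℚ.≤ sum (filter (correct? f x y) pairs) (clipped N)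
      win≤clipped = sum-mono (filter (correct? f x y) pairs)
        λ AB → ℚ.p≤q⊔p 0ℚ (seq (prob AB) N)
      rearrange : ∀ t v → 8ℚ ℚ.* (t ℚ.+ 1/32) ℚ.* (½ ℚ.* v) ≡
        1ℚ ℚ.+ (4ℚ ℚ.* (t ℚ.* v ℚ.+ ½ ℚ.- 1ℚ) ℚ.+ 1/8 ℚ.* (v ℚ.+ 1ℚ) ℚ.+ 7/8)
      rearrange = solve-∀ ring

    0≤hit : ∀ x y → 0ℚ ℚ.≤ hit x y
    0≤hit x y = sum-nonNeg (filter (correct? f x y) pairs) weight-nonNeg

    hit≤1 : ∀ x y → hit x y ℚ.≤ 1ℚ
    hit≤1 x y = begin
      hit x y
        ≡⟨ sum-filter (correct? f x y) pairs weight ⟩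
      sum pairs (λ AB → 𝟙 (correct? f x y AB) ℚ.* weight AB)
        ≤⟨ sum-mono pairs (λ AB → ℚ.≤-trans
             (*-monoʳ (weight-nonNeg AB) (𝟙≤1 (correct? f x y AB)))
             (ℚ.≤-reflexive (ℚ.*-identityˡ (weight AB)))) ⟩
      sum pairs weight
        ≤⟨ ∑weight≤1 ⟩
      1ℚ ∎
      where open ℚ.≤-Reasoning

    1≤M : 1ℚ ℚ.≤ M
    1≤M = ℚ.p≤q⊔p M₀ 1ℚ

    0<M : 0ℚ ℚ.< M
    0<M = ℚ.<-≤-trans (ℚ.positive⁻¹ 1ℚ) 1≤M

    M≤16T : Preimage f false → Preimage f true → ∀ n → N ℕ.≤ n → M ℚ.≤ 16ℚ ℚ.* seq T n
    M≤16T x y n N≤n = ℚ.≤-trans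
      (ℚ.≤-reflexive (ℚ.p≥q⇒p⊔q≡p 1≤M₀))
      (≤-by _ (0≤a+b (0≤a*b (ℚ.nonNegative⁻¹ 16ℚ) (0≤a-b (T-close n N≤n))) (0≤a-b 1≤M₀))
        (rearrange (seq T N) (seq T n)))
      where
      1≤M₀ : 1ℚ ℚ.≤ M₀
      1≤M₀ = ℚ.≤-trans (1≤M₀*hit x y)
        (ℚ.≤-trans (*-monoˡ 0≤M₀ (hit≤1 x y)) (ℚ.≤-reflexive (ℚ.*-identityʳ M₀)))
      rearrange : ∀ t s → 16ℚ ℚ.* s ≡
        8ℚ ℚ.* (t ℚ.+ 1/32) ℚ.+
        (16ℚ ℚ.* (s ℚ.+ 1/32 ℚ.- t) ℚ.+ (8ℚ ℚ.* (t ℚ.+ 1/32) ℚ.- 1ℚ))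
      rearrange = solve-∀ ring

    θ : ℚ
    θ = proj₁ (divide 0<M (ℚ.positive⁻¹ 1ℚ))

    0≤θ : 0ℚ ℚ.≤ θ
    0≤θ = ℚ.<⇒≤ (proj₁ (proj₂ (divide 0<M (ℚ.positive⁻¹ 1ℚ))))

    θ*M≡1 : θ ℚ.* M ≡ 1ℚ
    θ*M≡1 = proj₂ (proj₂ (divide 0<M (ℚ.positive⁻¹ 1ℚ)))

    θ≤hit : ∀ x y → θ ℚ.≤ hit x y
    θ≤hit x y = begin
      θ                      ≡⟨ ℚ.*-identityʳ θ ⟨
      θ ℚ.* 1ℚ               ≤⟨ *-monoˡ 0≤θ (ℚ.≤-trans (1≤M₀*hit x y)
                                  (*-monoʳ (0≤hit x y) (ℚ.p≤p⊔q M₀ 1ℚ))) ⟩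
      θ ℚ.* (M ℚ.* hit x y)  ≡⟨ ℚ.*-assoc θ M (hit x y) ⟨
      θ ℚ.* M ℚ.* hit x y    ≡⟨ cong (ℚ._* hit x y) θ*M≡1 ⟩
      1ℚ ℚ.* hit x y         ≡⟨ ℚ.*-identityˡ (hit x y) ⟩
      hit x y                ∎
      where open ℚ.≤-Reasoning

    -- 4M³ ≤ t eventually, and θ³/4 is the inverse of 4M³.
    1≤t*W : ∀ {u t W w} → T * T * T ≤ u → fromℚ (10ℚ ℚ.* 16³) * u ≤ t →
      Preimage f false → Preimage f true →
      (∀ n → seq W n ≡ w) → ½ ℚ.* θ ℚ.* θ ℚ.* (½ ℚ.* θ) ℚ.≤ w → 1ℝ ≤ t * W
    1≤t*W {u} {t} {W} {w} T³≤u Cu≤t x y W≡w θ³/4≤w ε 0<ε = eventually-map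
      (λ n ((M≤16Tₙ , T³≤u+δ) , Cu≤t+M³) →
        let 4M³≤t = 4M³≤ (seq T n) (seq u n) (seq t n) M≤16Tₙ T³≤u+δ Cu≤t+M³ in
        ℚ.≤-trans (≤-by ε (ℚ.<⇒≤ 0<ε) refl) (ℚ.+-monoˡ-≤ ε (begin
          1ℚ
            ≡⟨ cong₂ ℚ._*_ (cong₂ ℚ._*_ θ*M≡1 θ*M≡1) θ*M≡1 ⟨
          θ ℚ.* M ℚ.* (θ ℚ.* M) ℚ.* (θ ℚ.* M)
            ≡⟨ regroup θ M ⟩
          4ℚ ℚ.* M³ ℚ.* (½ ℚ.* θ ℚ.* θ ℚ.* (½ ℚ.* θ))
            ≤⟨ *-monoʳ 0≤θ³/4 4M³≤t ⟩
          seq t n ℚ.* (½ ℚ.* θ ℚ.* θ ℚ.* (½ ℚ.* θ))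
            ≤⟨ *-monoˡ (ℚ.≤-trans (0≤a*b (ℚ.nonNegative⁻¹ 4ℚ) (ℚ.<⇒≤ 0<M³)) 4M³≤t) θ³/4≤w ⟩
          seq t n ℚ.* w
            ≡⟨ cong (seq t n ℚ.*_) (W≡w n) ⟨
          seq t n ℚ.* seq W n ∎)))
      (eventually-×
        (eventually-× (N , M≤16T x y) (T³≤u δ 0<δ))
        (Cu≤t M³ 0<M³))
      where
      open ℚ.≤-Reasoning
      M³ : ℚ
      M³ = M ℚ.* M ℚ.* M
      0<* : ∀ {a b} → 0ℚ ℚ.< a → 0ℚ ℚ.< b → 0ℚ ℚ.< a ℚ.* b
      0<* {a} {b} 0<a 0<b =
        ℚ.positive⁻¹ _ {{ℚ.pos*pos⇒pos a {{ℚ.positive 0<a}} b {{ℚ.positive 0<b}}}}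
      0<M³ : 0ℚ ℚ.< M³
      0<M³ = 0<* (0<* 0<M 0<M) 0<M
      0<2k : 0ℚ ℚ.< 16³ ℚ.+ 16³
      0<2k = ℚ.positive⁻¹ (16³ ℚ.+ 16³)
      -- δ is M³/(2·16³). Multiplied by 10·16³, the cube of `T` contributes at least 10M³, the error
      -- δ costs 5M³ and the error in the bound on `t` costs M³. The remaining 4M³ explains the
      -- factor 10.
      δ : ℚ
      δ = proj₁ (divide 0<2k 0<M³)
      0<δ : 0ℚ ℚ.< δ
      0<δ = proj₁ (proj₂ (divide 0<2k 0<M³))
      δ*2k≡M³ : δ ℚ.* (16³ ℚ.+ 16³) ≡ M³
      δ*2k≡M³ = proj₂ (proj₂ (divide 0<2k 0<M³))
      0≤θ³/4 : 0ℚ ℚ.≤ ½ ℚ.* θ ℚ.* θ ℚ.* (½ ℚ.* θ)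
      0≤θ³/4 = 0≤a*b (0≤a*b (0≤a*b 0≤½ 0≤θ) 0≤θ) (0≤a*b 0≤½ 0≤θ)
      regroup : ∀ θ M → θ ℚ.* M ℚ.* (θ ℚ.* M) ℚ.* (θ ℚ.* M) ≡
        4ℚ ℚ.* (M ℚ.* M ℚ.* M) ℚ.* (½ ℚ.* θ ℚ.* θ ℚ.* (½ ℚ.* θ))
      regroup = solve-∀ ring
      cube-* : ∀ c τ → c ℚ.* τ ℚ.* (c ℚ.* τ) ℚ.* (c ℚ.* τ) ≡ c ℚ.* c ℚ.* c ℚ.* (τ ℚ.* τ ℚ.* τ)
      cube-* = solve-∀ ring
      rearrange : ∀ s u t k δ → t ≡ 4ℚ ℚ.* (δ ℚ.* (k ℚ.+ k)) ℚ.+ (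
        (t ℚ.+ δ ℚ.* (k ℚ.+ k) ℚ.- 10ℚ ℚ.* k ℚ.* u)
        ℚ.+ 10ℚ ℚ.* k ℚ.* (u ℚ.+ δ ℚ.- s)
        ℚ.+ 10ℚ ℚ.* (k ℚ.* s ℚ.- δ ℚ.* (k ℚ.+ k)))
      rearrange = solve-∀ ring
      4M³≤ : ∀ τ u t → M ℚ.≤ 16ℚ ℚ.* τ → τ ℚ.* τ ℚ.* τ ℚ.≤ u ℚ.+ δ →
        10ℚ ℚ.* 16³ ℚ.* u ℚ.≤ t ℚ.+ M³ → 4ℚ ℚ.* M³ ℚ.≤ t
      4M³≤ τ u t M≤16τ τ³≤ Cu≤ = subst (λ m → 4ℚ ℚ.* m ℚ.≤ t) δ*2k≡M³
        (≤-by _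
          (0≤a+b (0≤a+b (0≤a-b Cu≤′) (0≤a*b 0≤10k (0≤a-b τ³≤)))
                 (0≤a*b (ℚ.nonNegative⁻¹ 10ℚ) (0≤a-b m≤kτ³)))
          (rearrange (τ ℚ.* τ ℚ.* τ) u t 16³ δ))
        where
        0≤10k : 0ℚ ℚ.≤ 10ℚ ℚ.* 16³
        0≤10k = ℚ.nonNegative⁻¹ (10ℚ ℚ.* 16³)
        Cu≤′ : 10ℚ ℚ.* 16³ ℚ.* u ℚ.≤ t ℚ.+ δ ℚ.* (16³ ℚ.+ 16³)
        Cu≤′ = ℚ.≤-trans Cu≤ (ℚ.≤-reflexive (cong (t ℚ.+_) (sym δ*2k≡M³)))
        m≤kτ³ : δ ℚ.* (16³ ℚ.+ 16³) ℚ.≤ 16³ ℚ.* (τ ℚ.* τ ℚ.* τ)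
        m≤kτ³ = ℚ.≤-trans (ℚ.≤-reflexive δ*2k≡M³)
          (ℚ.≤-trans (cube-mono (ℚ.<⇒≤ 0<M) M≤16τ) (ℚ.≤-reflexive (cube-* 16ℚ τ)))

-- The total mass equals the sum of a marginal over `Fin 0`, which is empty, yet it is eventually at
-- least ½. This settles the case in which `topUp` has no coordinate to fill.
no-public-strategy : (f : BoolFun 0) → ¬ PublicStrategy f
no-public-strategy f P = ℚ.<-irrefl refl (ℚ.<-≤-trans (ℚ.positive⁻¹ ½) (begin
  ½                  ≤⟨ ≤-by _ (0≤a-b (1≤total+½ N ℕ.≤-refl)) (rearrange total) ⟩
  total              ≡⟨ seq-∑ (strategyPairs f) prob N ⟩
  sum (strategyPairs f) (λ AB → seq (prob AB) N)
                     ≡⟨ sum-marginal (strategyPairs f) (λ AB → seq (prob AB) N)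
                          (output f (f []) (proj₁ (position f []))) ⟨
  0ℚ                 ∎))
  where
  open ℚ.≤-Reasoning
  open PublicStrategy P
  N = proj₁ (proj₂ (IsDistribution.total isDistribution) ½ (ℚ.positive⁻¹ ½))
  1≤total+½ = proj₂ (proj₂ (IsDistribution.total isDistribution) ½ (ℚ.positive⁻¹ ½))
  total = seq (∑ (strategyPairs f) prob) N
  rearrange : ∀ s → s ≡ ½ ℚ.+ (s ℚ.+ ½ ℚ.- 1ℚ)
  rearrange = solve-∀ ring

module _ {n} (f : BoolFun (suc n)) (P : PublicStrategy f) (T : ℝ) {N} (acc : Accurate f P T N) where

  private
    w : StrategyPair f → ℚ
    w = weight f P T acc

    0≤w : ∀ AB → 0ℚ ℚ.≤ w AB
    0≤w = weight-nonNeg f P T acc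

    own : ∀ x → StrategyPair f → Fin (suc n)
    own x = output f (f x) (proj₁ (position f x))

  accurate⇒private :
    Σ[ p ∈ (Vec Bool (suc n) → Fin (suc n) → ℚ) ]
      (∀ x i → 0ℚ ℚ.≤ p x i) × (∀ x → sum (allFin (suc n)) (p x) ≡ 1ℚ) ×
      (∀ x y → f y ≢ f x → ½ ℚ.* θ f P T acc ℚ.* θ f P T acc ℚ.* (½ ℚ.* θ f P T acc)
        ℚ.≤ sum (differing x y) (λ i → p x i ℚ.* p y i))
  accurate⇒private = covers⇒private f (0≤θ f P T acc)
    (λ x → marginal-nonNeg (strategyPairs f) w (own x) 0≤w)
    (λ x → ℚ.≤-trans (ℚ.≤-reflexive (sum-marginal (strategyPairs f) w (own x)))
                     (∑weight≤1 f P T acc))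
    (coverWeight-covers f w 0≤w (θ≤hit f P T acc))

  accurate⇒wins : ∀ {u t} → T * T * T ≤ u → fromℚ (10ℚ ℚ.* 16³) * u ≤ t →
    Σ[ p ∈ PrivateStrategy (suc n) ]
      (∀ x y → 1ℝ ≤ t * privateWin p (input f false x) (input f true y))
  accurate⇒wins {u} {t} T³≤u Cu≤t = strategy , λ x y →
    let x′ = input f false x
        y′ = input f true y
    in 1≤t*W f P T acc {u} {t} {privateWin strategy x′ y′} T³≤u Cu≤t x y
         (seq-∑ (differing x′ y′) (λ i → fromℚ (p x′ i) * fromℚ (p y′ i)))
         (proj₂ (proj₂ (proj₂ accurate⇒private)) x′ y′ (input-separated f x y))
    where
    p : Vec Bool (suc n) → Fin (suc n) → ℚ
    p = proj₁ accurate⇒private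
    strategy : PrivateStrategy (suc n)
    strategy = rational p (proj₁ (proj₂ accurate⇒private)) (proj₁ (proj₂ (proj₂ accurate⇒private)))

public⇒private : ∀ {n} (f : BoolFun n) (P : PublicStrategy f) {T u t} → 0ℝ ≤ T →
  (∀ x y → 1ℝ ≤ T * publicWin f P x y) → T * T * T ≤ u → fromℚ (10ℚ ℚ.* 16³) * u ≤ t →
  Σ[ p ∈ PrivateStrategy n ]
    (∀ x y → 1ℝ ≤ t * privateWin p (input f false x) (input f true y))
public⇒private {zero}  f P 0≤T 1≤Tw T³≤u Cu≤t = ⊥-elim (no-public-strategy f P)
public⇒private {suc n} f P {T} {u} {t} 0≤T 1≤Tw T³≤u Cu≤t =
  accurate⇒wins f P T (proj₂ accurate (proj₁ accurate) ℕ.≤-refl) {u} {t} T³≤u Cu≤t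
  where
  accurate : Eventually (Accurate f P T)
  accurate = eventually-accurate f P T 0≤T 1≤Tw

0≤10*16³ : 0ℝ ≤ fromℚ (10ℚ ℚ.* 16³)
0≤10*16³ = ≤-fromSeq {0ℝ} {fromℚ (10ℚ ℚ.* 16³)} λ _ → ℚ.nonNegative⁻¹ (10ℚ ℚ.* 16³)

CGpriv≤CGpub³ : ∀ {n} (f : BoolFun n) → CGpriv f ≤∞ fromℚ (10ℚ ℚ.* 16³) · CGpub f ³
CGpriv≤CGpub³ f t (u , (T , (P , 0≤T , wins) , T³≤u) , Cu≤t) =
  proj₁ private-strategy , 0≤t , λ (x , y) → 0≤t , proj₂ private-strategy x y
  where
  private-strategy = public⇒private f P {T} {u} {t} 0≤T (λ x y → proj₂ (wins (x , y))) T³≤u Cu≤t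
  -- The maximum demands a nonnegative bound even for constant `f`; it is inherited from `T` through
  -- the cube and the scaling.
  0≤u : 0ℝ ≤ u
  0≤u = ≤-trans {0ℝ} {T * T * T} {u}
    (*-nonNeg {T * T} {T} (*-nonNeg {T} {T} 0≤T 0≤T) 0≤T) T³≤u
  0≤t : 0ℝ ≤ t
  0≤t = ≤-trans {0ℝ} {fromℚ (10ℚ ℚ.* 16³) * u} {t}
    (*-nonNeg {fromℚ (10ℚ ℚ.* 16³)} {u} 0≤10*16³ 0≤u) Cu≤t

corollary10p1 : Σ[ C ∈ ℝ ] (0ℝ ≤ C × (∀ (n : ℕ) (f : BoolFun n) → (CGpub f ≤∞ CGpriv f) × (CGpriv f ≤∞ C · CGpub f ³)))
corollary10p1 =
  fromℚ (10ℚ ℚ.* 16³) , 0≤10*16³ , λ n f → CGpub≤CGpriv f , CGpriv≤CGpub³ f
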